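{- Let $V$ be a finite set (the vertex set of a graph or hypergraph). A \emph{bad setting} is a pair $(Z,c)$ with $Z\subset V$ and $c$ a coloring of $Z$ (with colors from $\mathbb{N}$); fix a family of bad settings. Let $\mathcal{Z}=\{Z\subset V:\ \exists c \text{ such that } (Z,c) \text{ is a bad setting}\}$, indexed as $\{Z_i\}_{i\in I}$ with $I\subset\mathbb{N}$ finite. For each $i\in I$ let $C_i=\{c: (Z_i,c)\text{ is a bad setting}\}$, and suppose there are integers $0\le k_i<|Z_i|$ and $m_i\ge 1$ such that for every vertex $v\in Z_i$ there is a set $K_{i,v}\subset Z_i\setminus\{v\}$ with $|K_{i,v}|=k_i$ such that every coloring of $K_{i,v}$ extends in at most $m_i$ ways to a coloring $c\in C_i$ of $Z_i$. Put $l_i=|Z_i|-k_i$ and $E=\{l\in\mathbb{N}:\exists i\in I,\ l_i=l\}$. For $l\in E$ and $v\in V$ let $Q_l(v)$ be the set of sets $Z_j\in\mathcal{Z}$ with $v\in Z_j$ and $l_j=l$, and let $d_l=\max_{v\in V}|Q_l(v)|$. Let $\phi_E(x)=1+\sum_{l\in E}x^l$, let $\tau>0$ satisfy $\phi_E(\tau)-\tau\phi_E'(\tau)=0$ (assumed to exist), and set $\gamma=\phi_E'(\tau)$. Then there exists a coloring of $V$ using $\left\lceil \gamma \sup_{i\in I}(d_{l_i}m_i)^{1/l_i}\right\rceil$ colors that avoids all bad settings, i.e. for no $i\in I$ is its restriction to $Z_i$ an element of $C_i$.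
   Context: A coloring of $V$ avoids a bad setting $(Z,c)$ if its restriction to $Z$ is not equal to $c$. -}

module Defs where

open import Data.Nat.Base as ℕ using (ℕ; zero; suc; z≤n; s≤s)
import Data.Nat.Properties as ℕₚ
open import Data.Nat.Solver renaming (module +-*-Solver to ℕ-Solver)
open import Data.Integer.Base as ℤ using (+_; +[1+_])
import Data.Integer.Properties as ℤₚ
open import Data.Rational.Base as ℚ using (ℚ; 0ℚ; 1ℚ; ½; mkℚ)
import Data.Rational.Properties as ℚₚ
open import Data.Rational.Solver using (module +-*-Solver)
open import Data.Rational.Unnormalised.Base as ℚᵘ using (mkℚᵘ)
import Data.Rational.Unnormalised.Properties as ℚᵘₚ
open import Data.Fin.Base using (Fin)
open import Data.Fin.Subset using (Subset; _∈_; _⊆_; _-_; ∣_∣)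
open import Data.Fin.Subset.Properties using (_∈?_)
open import Data.Bool.Properties using () renaming (_≟_ to _≟ᵇ_)
open import Data.List.Base
  using (List; []; _∷_; map; foldr; filter; deduplicate; length; allFin)
open import Data.List.Extrema.Nat using (max)
open import Data.List.Relation.Unary.All using (All)
open import Data.List.Relation.Unary.AllPairs using (AllPairs)
open import Data.Product.Base using (_×_; _,_; proj₁; proj₂; ∃; ∃-syntax)
open import Data.Sum.Base using (inj₁; inj₂)
open import Data.Vec.Properties using (≡-dec)
open import Relation.Nullary.Decidable using (yes; no; _×-dec_)
open import Relation.Nullary.Negation using (¬_; contradiction)
open import Relation.Binary.PropositionalEquality
  using (_≡_; refl; sym; trans; cong; cong₂; subst; module ≡-Reasoning)

------------------------------------------------------------------------
-- Real numbers, as Cauchy sequences of rationals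

Cauchy : (ℕ → ℚ) → Set
Cauchy s = ∀ ε → 0ℚ ℚ.< ε →
  ∃[ N ] (∀ m n → N ℕ.≤ m → N ℕ.≤ n → ℚ.∣ s m ℚ.- s n ∣ ℚ.< ε)

record ℝ : Set where
  constructor mkℝ
  field
    seq    : ℕ → ℚ
    cauchy : Cauchy seq

open ℝ public

infix 4 _≈ℝ_ _≤ℝ_ _<ℝ_

_≈ℝ_ _≤ℝ_ _<ℝ_ : ℝ → ℝ → Set
x ≈ℝ y = ∀ ε → 0ℚ ℚ.< ε →
  ∃[ N ] (∀ n → N ℕ.≤ n → ℚ.∣ seq x n ℚ.- seq y n ∣ ℚ.< ε)
x ≤ℝ y = ∀ ε → 0ℚ ℚ.< ε →
  ∃[ N ] (∀ n → N ℕ.≤ n → seq x n ℚ.≤ seq y n ℚ.+ ε)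
x <ℝ y = ∃[ ε ] 0ℚ ℚ.< ε ×
  ∃[ N ] (∀ n → N ℕ.≤ n → seq x n ℚ.+ ε ℚ.≤ seq y n)

half : ∀ ε → 0ℚ ℚ.< ε → ∃[ h ] 0ℚ ℚ.< h × h ℚ.+ h ≡ ε
half ε 0<ε = ½ ℚ.* ε
  , ℚₚ.<-respˡ-≡ (ℚₚ.*-zeroʳ ½) (ℚₚ.*-monoʳ-<-pos ½ 0<ε)
  , trans (sym (ℚₚ.*-distribʳ-+ ε ½ ½)) (ℚₚ.*-identityˡ ε)

∣p∣<ε : ∀ {p ε} → p ℚ.< ε → ℚ.- p ℚ.< ε → ℚ.∣ p ∣ ℚ.< ε
∣p∣<ε {p} {ε} p<ε -p<ε with ℚₚ.∣p∣≡p∨∣p∣≡-p p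
... | inj₁ eq = subst (ℚ._< ε) (sym eq) p<ε
... | inj₂ eq = subst (ℚ._< ε) (sym eq) -p<ε

p≤∣p∣ : ∀ p → p ℚ.≤ ℚ.∣ p ∣
p≤∣p∣ p with ℚₚ.≤-total 0ℚ p
... | inj₁ 0≤p = ℚₚ.≤-reflexive (sym (ℚₚ.0≤p⇒∣p∣≡p 0≤p))
... | inj₂ p≤0 = ℚₚ.≤-trans p≤0 (ℚₚ.nonNegative⁻¹ _ {{ℚₚ.∣-∣-nonNeg p}})

neg-sub : ∀ p q → ℚ.- (p ℚ.- q) ≡ q ℚ.- p
neg-sub = solve 2 (λ p q → :- (p :- q) := q :- p) refl
  where open +-*-Solver

cancel : ∀ q ε → q ℚ.+ ε ℚ.- q ≡ ε
cancel = solve 2 (λ q ε → q :+ ε :- q := ε) refl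
  where open +-*-Solver

cancel′ : ∀ p q → q ℚ.+ (p ℚ.- q) ≡ p
cancel′ = solve 2 (λ p q → q :+ (p :- q) := p) refl
  where open +-*-Solver

sub< : ∀ {p q ε} → p ℚ.< q ℚ.+ ε → p ℚ.- q ℚ.< ε
sub< {p} {q} {ε} h = subst (p ℚ.- q ℚ.<_) (cancel q ε) (ℚₚ.+-monoˡ-< (ℚ.- q) h)

<+ : ∀ {p q ε} → ℚ.∣ p ℚ.- q ∣ ℚ.< ε → p ℚ.< q ℚ.+ ε
<+ {p} {q} {ε} h = subst (ℚ._< q ℚ.+ ε) (cancel′ p q)
  (ℚₚ.+-monoʳ-< q (ℚₚ.≤-<-trans (p≤∣p∣ (p ℚ.- q)) h))

-- It suffices to bound the differences from one side.
cauchy⁺ : ∀ s →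
  (∀ ε → 0ℚ ℚ.< ε → ∃[ N ] (∀ m n → N ℕ.≤ m → N ℕ.≤ n → s m ℚ.< s n ℚ.+ ε)) →
  Cauchy s
cauchy⁺ s h ε 0<ε with h ε 0<ε
... | N , b = N , λ m n N≤m N≤n →
  ∣p∣<ε (sub< (b m n N≤m N≤n))
    (subst (ℚ._< ε) (sym (neg-sub (s m) (s n))) (sub< (b n m N≤n N≤m)))

cauchy⁻ : ∀ s → Cauchy s →
  ∀ ε → 0ℚ ℚ.< ε → ∃[ N ] (∀ m n → N ℕ.≤ m → N ℕ.≤ n → s m ℚ.< s n ℚ.+ ε)
cauchy⁻ s h ε 0<ε with h ε 0<ε
... | N , b = N , λ m n N≤m N≤n → <+ (b m n N≤m N≤n)

const-cauchy : ∀ q → Cauchy (λ _ → q)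
const-cauchy q = cauchy⁺ (λ _ → q) λ ε 0<ε → 0 , λ _ _ _ _ →
  subst (ℚ._< q ℚ.+ ε) (ℚₚ.+-identityʳ q) (ℚₚ.+-monoʳ-< q 0<ε)

+-interchange : ∀ a b h → (a ℚ.+ h) ℚ.+ (b ℚ.+ h) ≡ (a ℚ.+ b) ℚ.+ (h ℚ.+ h)
+-interchange = solve 3 (λ a b h → (a :+ h) :+ (b :+ h) := (a :+ b) :+ (h :+ h)) refl
  where open +-*-Solver

+-cauchy : ∀ s t → Cauchy s → Cauchy t → Cauchy (λ n → s n ℚ.+ t n)
+-cauchy s t cs ct = cauchy⁺ (λ n → s n ℚ.+ t n) λ ε 0<ε →
  let h , 0<h , h+h≡ε = half ε 0<ε
      M , f = cauchy⁻ s cs h 0<h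
      N , g = cauchy⁻ t ct h 0<h
  in M ℕ.⊔ N , λ m n p q →
    subst (s m ℚ.+ t m ℚ.<_)
      (trans (+-interchange (s n) (t n) h) (cong (s n ℚ.+ t n ℚ.+_) h+h≡ε))
      (ℚₚ.+-mono-< (f m n (ℕₚ.m⊔n≤o⇒m≤o M N p) (ℕₚ.m⊔n≤o⇒m≤o M N q))
                   (g m n (ℕₚ.m⊔n≤o⇒n≤o M N p) (ℕₚ.m⊔n≤o⇒n≤o M N q)))

neg-cauchy : ∀ s → Cauchy s → Cauchy (λ n → ℚ.- s n)
neg-cauchy s cs ε 0<ε with cs ε 0<ε
... | N , f = N , λ m n p q →
  subst (λ z → ℚ.∣ z ∣ ℚ.< ε) (eq (s n) (s m)) (f n m q p)
  where
  open +-*-Solver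
  eq : ∀ a b → a ℚ.- b ≡ (ℚ.- b) ℚ.- (ℚ.- a)
  eq = solve 2 (λ a b → a :- b := (:- b) :- (:- a)) refl

⊔-mono-<+ : ∀ a b c d ε → a ℚ.< c ℚ.+ ε → b ℚ.< d ℚ.+ ε →
  a ℚ.⊔ b ℚ.< (c ℚ.⊔ d) ℚ.+ ε
⊔-mono-<+ a b c d ε a< b< with ℚₚ.≤-total a b
... | inj₁ a≤b = subst (ℚ._< (c ℚ.⊔ d) ℚ.+ ε) (sym (ℚₚ.p≤q⇒p⊔q≡q a≤b))
  (ℚₚ.<-≤-trans b< (ℚₚ.+-monoˡ-≤ ε (ℚₚ.p≤q⊔p c d)))
... | inj₂ b≤a = subst (ℚ._< (c ℚ.⊔ d) ℚ.+ ε) (sym (ℚₚ.p≥q⇒p⊔q≡p b≤a))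
  (ℚₚ.<-≤-trans a< (ℚₚ.+-monoˡ-≤ ε (ℚₚ.p≤p⊔q c d)))

⊔-cauchy : ∀ s t → Cauchy s → Cauchy t → Cauchy (λ n → s n ℚ.⊔ t n)
⊔-cauchy s t cs ct = cauchy⁺ (λ n → s n ℚ.⊔ t n) λ ε 0<ε →
  let M , f = cauchy⁻ s cs ε 0<ε
      N , g = cauchy⁻ t ct ε 0<ε
  in M ℕ.⊔ N , λ m n p q → ⊔-mono-<+ (s m) (t m) (s n) (t n) ε
    (f m n (ℕₚ.m⊔n≤o⇒m≤o M N p) (ℕₚ.m⊔n≤o⇒m≤o M N q))
    (g m n (ℕₚ.m⊔n≤o⇒n≤o M N p) (ℕₚ.m⊔n≤o⇒n≤o M N q))

0<1 : 0ℚ ℚ.< 1ℚ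
0<1 = ℚₚ.positive⁻¹ 1ℚ

bounded : ∀ s → Cauchy s →
  ∃[ A ] ℚ.Positive A × ∃[ N ] (∀ n → N ℕ.≤ n → ℚ.∣ s n ∣ ℚ.≤ A)
bounded s cs with cs 1ℚ 0<1
... | N , f = A , ℚₚ.nonNeg+pos⇒pos ℚ.∣ s N ∣ {{ℚₚ.∣-∣-nonNeg (s N)}} 1ℚ , N , bound
  where
  A = ℚ.∣ s N ∣ ℚ.+ 1ℚ
  bound : ∀ n → N ℕ.≤ n → ℚ.∣ s n ∣ ℚ.≤ A
  bound n N≤n = subst (λ z → ℚ.∣ z ∣ ℚ.≤ A) (cancel′ (s n) (s N))
    (ℚₚ.≤-trans (ℚₚ.∣p+q∣≤∣p∣+∣q∣ (s N) (s n ℚ.- s N))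
      (ℚₚ.+-monoʳ-≤ ℚ.∣ s N ∣ (ℚₚ.<⇒≤ (f n N N≤n ℕₚ.≤-refl))))

regroup : ∀ a b e i →
  a ℚ.* (e ℚ.* i) ℚ.+ (e ℚ.* i) ℚ.* b ≡ e ℚ.* (i ℚ.* (a ℚ.+ b))
regroup = solve 4
  (λ a b e i → a :* (e :* i) :+ (e :* i) :* b := e :* (i :* (a :+ b))) refl
  where open +-*-Solver

split : ∀ a b c d → a ℚ.* (b ℚ.- d) ℚ.+ (a ℚ.- c) ℚ.* d ≡ a ℚ.* b ℚ.- c ℚ.* d
split = solve 4
  (λ a b c d → a :* (b :- d) :+ (a :- c) :* d := a :* b :- c :* d) refl
  where open +-*-Solver

portion : ∀ A B ε → ℚ.Positive A → ℚ.Positive B → 0ℚ ℚ.< ε →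
  ∃[ δ ] 0ℚ ℚ.< δ × A ℚ.* δ ℚ.+ δ ℚ.* B ≡ ε
portion A B ε posA posB 0<ε = ε ℚ.* i
  , ℚₚ.<-respˡ-≡ (ℚₚ.*-zeroˡ i) (ℚₚ.*-monoˡ-<-pos i 0<ε)
  , trans (regroup A B ε i)
      (trans (cong (ε ℚ.*_) (ℚₚ.*-inverseˡ (A ℚ.+ B))) (ℚₚ.*-identityʳ ε))
  where
  instance
    posAB : ℚ.Positive (A ℚ.+ B)
    posAB = ℚₚ.pos+pos⇒pos A {{posA}} B {{posB}}
    nzAB : ℚ.NonZero (A ℚ.+ B)
    nzAB = ℚₚ.pos⇒nonZero (A ℚ.+ B)
  i : ℚ
  i = ℚ.1/ (A ℚ.+ B)
  instance
    posi : ℚ.Positive i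
    posi = ℚₚ.1/pos⇒pos (A ℚ.+ B)

product-bound : ∀ a b c d A B δ → ℚ.Positive A → ℚ.Positive B →
  ℚ.∣ a ∣ ℚ.≤ A → ℚ.∣ d ∣ ℚ.≤ B →
  ℚ.∣ a ℚ.- c ∣ ℚ.< δ → ℚ.∣ b ℚ.- d ∣ ℚ.< δ →
  ℚ.∣ a ℚ.* b ℚ.- c ℚ.* d ∣ ℚ.< A ℚ.* δ ℚ.+ δ ℚ.* B
product-bound a b c d A B δ posA posB a≤A d≤B ac<δ bd<δ = begin-strict
  ℚ.∣ a ℚ.* b ℚ.- c ℚ.* d ∣
    ≡⟨ cong ℚ.∣_∣ (sym (split a b c d)) ⟩
  ℚ.∣ a ℚ.* (b ℚ.- d) ℚ.+ (a ℚ.- c) ℚ.* d ∣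
    ≤⟨ ℚₚ.∣p+q∣≤∣p∣+∣q∣ (a ℚ.* (b ℚ.- d)) ((a ℚ.- c) ℚ.* d) ⟩
  ℚ.∣ a ℚ.* (b ℚ.- d) ∣ ℚ.+ ℚ.∣ (a ℚ.- c) ℚ.* d ∣
    ≡⟨ cong₂ ℚ._+_ (ℚₚ.∣p*q∣≡∣p∣*∣q∣ a (b ℚ.- d)) (ℚₚ.∣p*q∣≡∣p∣*∣q∣ (a ℚ.- c) d) ⟩
  ℚ.∣ a ∣ ℚ.* ℚ.∣ b ℚ.- d ∣ ℚ.+ ℚ.∣ a ℚ.- c ∣ ℚ.* ℚ.∣ d ∣
    ≤⟨ ℚₚ.+-mono-≤
         (ℚₚ.*-monoʳ-≤-nonNeg ℚ.∣ b ℚ.- d ∣ {{ℚₚ.∣-∣-nonNeg (b ℚ.- d)}} a≤A)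
         (ℚₚ.*-monoˡ-≤-nonNeg ℚ.∣ a ℚ.- c ∣ {{ℚₚ.∣-∣-nonNeg (a ℚ.- c)}} d≤B) ⟩
  A ℚ.* ℚ.∣ b ℚ.- d ∣ ℚ.+ ℚ.∣ a ℚ.- c ∣ ℚ.* B
    <⟨ ℚₚ.+-mono-< (ℚₚ.*-monoʳ-<-pos A {{posA}} bd<δ) (ℚₚ.*-monoˡ-<-pos B {{posB}} ac<δ) ⟩
  A ℚ.* δ ℚ.+ δ ℚ.* B ∎
  where open ℚₚ.≤-Reasoning

*-cauchy : ∀ s t → Cauchy s → Cauchy t → Cauchy (λ n → s n ℚ.* t n)
*-cauchy s t cs ct ε 0<ε =
  let A , posA , M , bs = bounded s cs
      B , posB , N , bt = bounded t ct
      δ , 0<δ , total   = portion A B ε posA posB 0<ε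
      M′ , f = cs δ 0<δ
      N′ , g = ct δ 0<δ
      K  = M ℕ.⊔ N
      K′ = M′ ℕ.⊔ N′
  in K ℕ.⊔ K′ , λ m n p q →
    let p′ = ℕₚ.m⊔n≤o⇒n≤o K K′ p
        q′ = ℕₚ.m⊔n≤o⇒n≤o K K′ q
    in subst (ℚ.∣ s m ℚ.* t m ℚ.- s n ℚ.* t n ∣ ℚ.<_) total
      (product-bound (s m) (t m) (s n) (t n) A B δ posA posB
        (bs m (ℕₚ.m⊔n≤o⇒m≤o M N (ℕₚ.m⊔n≤o⇒m≤o K K′ p)))
        (bt n (ℕₚ.m⊔n≤o⇒n≤o M N (ℕₚ.m⊔n≤o⇒m≤o K K′ q)))
        (f m n (ℕₚ.m⊔n≤o⇒m≤o M′ N′ p′) (ℕₚ.m⊔n≤o⇒m≤o M′ N′ q′))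
        (g m n (ℕₚ.m⊔n≤o⇒n≤o M′ N′ p′) (ℕₚ.m⊔n≤o⇒n≤o M′ N′ q′)))

infixr 8 _^ℝ_
infixl 7 _*ℝ_
infixl 6 _+ℝ_ _-ℝ_ _⊔ℝ_

fromℚ : ℚ → ℝ
fromℚ q = mkℝ (λ _ → q) (const-cauchy q)

fromℕ : ℕ → ℝ
fromℕ n = fromℚ (+ n ℚ./ 1)

0ℝ 1ℝ : ℝ
0ℝ = fromℕ 0
1ℝ = fromℕ 1

_+ℝ_ _*ℝ_ _-ℝ_ _⊔ℝ_ : ℝ → ℝ → ℝ
x +ℝ y = mkℝ (λ n → seq x n ℚ.+ seq y n) (+-cauchy (seq x) (seq y) (cauchy x) (cauchy y))
x *ℝ y = mkℝ (λ n → seq x n ℚ.* seq y n) (*-cauchy (seq x) (seq y) (cauchy x) (cauchy y))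
x ⊔ℝ y = mkℝ (λ n → seq x n ℚ.⊔ seq y n) (⊔-cauchy (seq x) (seq y) (cauchy x) (cauchy y))
x -ℝ y = mkℝ (λ n → seq x n ℚ.- seq y n)
  (+-cauchy (seq x) (λ n → ℚ.- seq y n) (cauchy x) (neg-cauchy (seq y) (cauchy y)))

_^ℝ_ : ℝ → ℕ → ℝ
x ^ℝ zero  = 1ℝ
x ^ℝ suc n = x *ℝ x ^ℝ n

-- N = ⌈x⌉ for x ≥ 0, i.e. N - 1 < x ≤ N.
IsCeiling : ℝ → ℕ → Set
IsCeiling x N = x ≤ℝ fromℕ N × fromℕ N <ℝ x +ℝ 1ℝ

-- The supremum of finitely many non-negative reals, one for each i in I;
-- the base value 0 is only attained by this maximum when I is empty or all
-- the reals are 0.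
sup : List ℕ → (ℕ → ℝ) → ℝ
sup I f = foldr _⊔ℝ_ 0ℝ (map f I)

-- The largest p ≤ b with p ^ l ≤ a (for l ≥ 1).
greatest : (l a b : ℕ) → ℕ
greatest l a zero    = 0
greatest l a (suc b) with suc b ℕ.^ l ℕₚ.≤? a
... | yes _ = suc b
... | no  _ = greatest l a b

-- ⌊a^(1/l)⌋ for l ≥ 1.
⌊root⌋ : (l a : ℕ) → ℕ
⌊root⌋ l a = greatest l a a

⌊root⌋-≤ : ∀ l a → ⌊root⌋ (suc l) a ℕ.^ suc l ℕ.≤ a
⌊root⌋-≤ l a = go a
  where
  go : ∀ b → greatest (suc l) a b ℕ.^ suc l ℕ.≤ a
  go zero = z≤n
  go (suc b) with suc b ℕ.^ suc l ℕₚ.≤? a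
  ... | yes p = p
  ... | no  _ = go b

⌊root⌋-< : ∀ l a → a ℕ.< suc (⌊root⌋ (suc l) a) ℕ.^ suc l
⌊root⌋-< l a = go a (ℕₚ.m≤m*n (suc a) (suc a ℕ.^ l) {{ℕₚ.m^n≢0 (suc a) l}})
  where
  go : ∀ b → a ℕ.< suc b ℕ.^ suc l → a ℕ.< suc (greatest (suc l) a b) ℕ.^ suc l
  go zero h = h
  go (suc b) h with suc b ℕ.^ suc l ℕₚ.≤? a
  ... | yes _ = h
  ... | no ¬p = go b (ℕₚ.≰⇒> ¬p)

-- The sequence ⌊(a (n+1)^l)^(1/l)⌋ / (n+1), converging to a^(1/l) for l ≥ 1.
rootSeq : (l a : ℕ) → ℕ → ℚ
rootSeq l a n = + ⌊root⌋ l (a ℕ.* suc n ℕ.^ l) ℚ./ suc n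

^-cancelʳ-< : ∀ l {p q} → p ℕ.^ l ℕ.< q ℕ.^ l → p ℕ.< q
^-cancelʳ-< l {p} {q} h with p ℕₚ.<? q
... | yes p<q = p<q
... | no  p≮q = contradiction h (ℕₚ.≤⇒≯ (ℕₚ.^-monoˡ-≤ l (ℕₚ.≮⇒≥ p≮q)))

interchange : ∀ a b c d → (a ℕ.* b) ℕ.* (c ℕ.* d) ≡ (a ℕ.* c) ℕ.* (b ℕ.* d)
interchange = ℕ-Solver.solve 4
  (λ a b c d → (a :* b) :* (c :* d) := (a :* c) :* (b :* d)) refl
  where open ℕ-Solver using (_:*_; _:=_)

^-distribʳ-* : ∀ l p q → (p ℕ.* q) ℕ.^ l ≡ p ℕ.^ l ℕ.* q ℕ.^ l
^-distribʳ-* zero    p q = refl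
^-distribʳ-* (suc l) p q = trans (cong (p ℕ.* q ℕ.*_) (^-distribʳ-* l p q))
  (interchange p q (p ℕ.^ l) (q ℕ.^ l))

/-< : ∀ p q j k → p ℕ.* suc k ℕ.< q ℕ.* suc j →
  + p ℚ./ suc j ℚ.< + q ℚ./ suc k
/-< p q j k h = ℚₚ.toℚᵘ-cancel-<
  (ℚᵘₚ.<-respʳ-≃ (ℚᵘₚ.≃-sym (ℚₚ.toℚᵘ-fromℚᵘ (mkℚᵘ (+ q) k)))
    (ℚᵘₚ.<-respˡ-≃ (ℚᵘₚ.≃-sym (ℚₚ.toℚᵘ-fromℚᵘ (mkℚᵘ (+ p) j)))
      (ℚᵘ.*<* (subst₂′ (ℤ.+<+ h)))))
  where
  subst₂′ : + (p ℕ.* suc k) ℤ.< + (q ℕ.* suc j) →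
    + p ℤ.* + suc k ℤ.< + q ℤ.* + suc j
  subst₂′ g rewrite sym (ℤₚ.pos-* p (suc k)) | sym (ℤₚ.pos-* q (suc j)) = g

suc-/ : ∀ q k → + suc q ℚ./ suc k ≡ + q ℚ./ suc k ℚ.+ + 1 ℚ./ suc k
suc-/ q k = ℚₚ.toℚᵘ-injective
  (ℚᵘₚ.≃-trans (ℚₚ.toℚᵘ-fromℚᵘ (mkℚᵘ (+ suc q) k))
  (ℚᵘₚ.≃-trans (ℚᵘ.*≡* eq)
  (ℚᵘₚ.≃-trans
    (ℚᵘₚ.+-cong (ℚᵘₚ.≃-sym (ℚₚ.toℚᵘ-fromℚᵘ (mkℚᵘ (+ q) k)))
                (ℚᵘₚ.≃-sym (ℚₚ.toℚᵘ-fromℚᵘ (mkℚᵘ (+ 1) k))))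
    (ℚᵘₚ.≃-sym (ℚₚ.toℚᵘ-homo-+ (+ q ℚ./ suc k) (+ 1 ℚ./ suc k))))))
  where
  K = + suc k
  eq : + suc q ℤ.* (K ℤ.* K) ≡ (+ q ℤ.* K ℤ.+ + 1 ℤ.* K) ℤ.* K
  eq = begin
    + suc q ℤ.* (K ℤ.* K)               ≡⟨ sym (ℤₚ.*-assoc (+ suc q) K K) ⟩
    + suc q ℤ.* K ℤ.* K                 ≡⟨ cong (λ z → z ℤ.* K ℤ.* K) (cong +_ (ℕₚ.+-comm 1 q)) ⟩
    (+ q ℤ.+ + 1) ℤ.* K ℤ.* K           ≡⟨ cong (ℤ._* K) (ℤₚ.*-distribʳ-+ K (+ q) (+ 1)) ⟩
    (+ q ℤ.* K ℤ.+ + 1 ℤ.* K) ℤ.* K     ∎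
    where open ≡-Reasoning

archimedean : ∀ ε → 0ℚ ℚ.< ε → ∃[ N ] (∀ k → N ℕ.≤ k → + 1 ℚ./ suc k ℚ.< ε)
archimedean ε@(mkℚ +[1+ n ] d _) _ = suc d , λ k N≤k →
  subst (+ 1 ℚ./ suc k ℚ.<_) (ℚₚ.fromℚᵘ-toℚᵘ ε)
    (/-< 1 (suc n) k d (ℕₚ.<-≤-trans (ℕₚ.≤-<-trans (ℕₚ.≤-reflexive (ℕₚ.*-identityˡ (suc d))) (s≤s N≤k))
      (ℕₚ.m≤n*m (suc k) (suc n))))
archimedean (mkℚ (+ 0) _ _) (ℚ.*<* (ℤ.+<+ ()))
archimedean (mkℚ (ℤ.-[1+ _ ]) _ _) (ℚ.*<* ())

rootSeq-< : ∀ l a j k →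
  rootSeq (suc l) a j ℚ.< rootSeq (suc l) a k ℚ.+ + 1 ℚ./ suc k
rootSeq-< l a j k = subst (rootSeq (suc l) a j ℚ.<_) (suc-/ q k)
  (/-< p (suc q) j k (^-cancelʳ-< (suc l) (begin-strict
    (p ℕ.* suc k) ℕ.^ L
      ≡⟨ ^-distribʳ-* L p (suc k) ⟩
    p ℕ.^ L ℕ.* suc k ℕ.^ L
      ≤⟨ ℕₚ.*-monoˡ-≤ (suc k ℕ.^ L) (⌊root⌋-≤ l (a ℕ.* suc j ℕ.^ L)) ⟩
    a ℕ.* suc j ℕ.^ L ℕ.* suc k ℕ.^ L
      ≡⟨ swap a (suc j ℕ.^ L) (suc k ℕ.^ L) ⟩
    a ℕ.* suc k ℕ.^ L ℕ.* suc j ℕ.^ L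
      <⟨ ℕₚ.*-monoˡ-< (suc j ℕ.^ L) {{ℕₚ.m^n≢0 (suc j) L}} (⌊root⌋-< l (a ℕ.* suc k ℕ.^ L)) ⟩
    suc q ℕ.^ L ℕ.* suc j ℕ.^ L
      ≡⟨ sym (^-distribʳ-* L (suc q) (suc j)) ⟩
    (suc q ℕ.* suc j) ℕ.^ L ∎)))
  where
  open ℕₚ.≤-Reasoning
  L = suc l
  p = ⌊root⌋ L (a ℕ.* suc j ℕ.^ L)
  q = ⌊root⌋ L (a ℕ.* suc k ℕ.^ L)
  swap : ∀ x y z → x ℕ.* y ℕ.* z ≡ x ℕ.* z ℕ.* y
  swap x y z = trans (ℕₚ.*-assoc x y z)
    (trans (cong (x ℕ.*_) (ℕₚ.*-comm y z)) (sym (ℕₚ.*-assoc x z y)))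

rootSeq-cauchy : ∀ l a → Cauchy (rootSeq (suc l) a)
rootSeq-cauchy l a = cauchy⁺ (rootSeq (suc l) a) λ ε 0<ε →
  let N , h = archimedean ε 0<ε in
  N , λ m n _ N≤n → ℚₚ.<-trans (rootSeq-< l a m n)
    (ℚₚ.+-monoʳ-< (rootSeq (suc l) a n) (h n N≤n))

-- a^(1/l); the value for l = 0 is irrelevant.
root : (l a : ℕ) → ℝ
root zero    a = 0ℝ
root (suc l) a = mkℝ (rootSeq (suc l) a) (rootSeq-cauchy l a)

------------------------------------------------------------------------
-- Polynomials

-- A list of pairs (c , e) stands for the sum of the monomials c xᵉ.
Poly : Set
Poly = List (ℕ × ℕ)

eval : Poly → ℝ → ℝ
eval p x = foldr (λ (c , e) y → fromℕ c *ℝ x ^ℝ e +ℝ y) 0ℝ p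

derivative : Poly → Poly
derivative = map λ (c , e) → c ℕ.* e , e ℕ.∸ 1

ϕ : List ℕ → Poly
ϕ E = (1 , 0) ∷ map (1 ,_) E

------------------------------------------------------------------------
-- Colorings and bad settings on the vertex set V = Fin n

private
  variable
    n : ℕ

Coloring : Subset n → Set
Coloring Y = ∀ v → v ∈ Y → ℕ

infix 4 _≋_

_≋_ : {Y : Subset n} → Coloring Y → Coloring Y → Set
c ≋ c′ = ∀ v v∈Y → c v v∈Y ≡ c′ v v∈Y

restrict : (Fin n → ℕ) → (Y : Subset n) → Coloring Y
restrict f Y v _ = f v

-- c agrees with κ wherever both are defined.
Extends : {Y K : Subset n} → Coloring Y → Coloring K → Set
Extends {Y = Y} {K} c κ = ∀ v (v∈Y : v ∈ Y) (v∈K : v ∈ K) → c v v∈Y ≡ κ v v∈K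

BadSettings : ℕ → Set₁
BadSettings n = (Y : Subset n) → Coloring Y → Set

Avoids : BadSettings n → (Fin n → ℕ) → Set
Avoids Bad f = ∀ Y c → Bad Y c → ¬ (restrict f Y ≋ c)

-- At most m colorings, up to pointwise equality, satisfy P.
AtMost : {Y : Subset n} → ℕ → (Coloring Y → Set) → Set
AtMost m P = ∀ cs → All P cs → AllPairs (λ c c′ → ¬ (c ≋ c′)) cs → length cs ℕ.≤ m

-- The hypothesis on a set Y with set C of bad colorings and integers k, m.
FewExtensions : (Y : Subset n) (C : Coloring Y → Set) (k m : ℕ) → Set
FewExtensions {n} Y C k m = ∀ v → v ∈ Y →
  ∃[ K ] K ⊆ Y - v × ∣ K ∣ ≡ k ×
    ((κ : Coloring K) → AtMost m (λ c → C c × Extends c κ))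

-- The sets Zᵢ (i in the list I), with the associated integers kᵢ.
module Family (I : List ℕ) (Z : ℕ → Subset n) (k : ℕ → ℕ) where

  l : ℕ → ℕ
  l i = ∣ Z i ∣ ℕ.∸ k i

  E : List ℕ
  E = deduplicate ℕₚ._≟_ (map l I)

  -- Distinct indices may carry the same set, so repetitions are removed.
  Q : ℕ → Fin n → List (Subset n)
  Q e v = deduplicate (≡-dec _≟ᵇ_)
    (map Z (filter (λ j → (v ∈? Z j) ×-dec (l j ℕₚ.≟ e)) I))

  d : ℕ → ℕ
  d e = max 0 (map (λ v → length (Q e v)) (allFin n))

{-# OPTIONS --safe #-}

-- Rosenfeld's counting argument.  For S ⊆ V let G S be the number of colorings
-- of V with N colors that violate no bad setting inside S.  Write s for the
-- supremum, so that d(lᵢ) mᵢ ≤ s^lᵢ.  By induction on |S|,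
--     s · G (S - v) ≤ N τ · G S     for v ∈ S.
-- A coloring counted on the left but not on the right hits a bad setting on
-- some Z ∋ v; it is determined, up to m choices, by its values outside the l
-- vertices of Z ∖ K_v, so by induction there are at most
-- m N^-l (N τ / s)^(l-1) G (S - v) of them.  Summing over Z, at most
-- (s / N τ) Σ_{l∈E} τ^l G (S - v) colorings are lost, and since
-- N τ ≥ γ s τ = s ϕ_E(τ) what remains is at least (s / N τ) G (S - v).
module Submission where

open import Defs
open import Axiom.ExcludedMiddle using (ExcludedMiddle)
open import Data.Bool.Base using (Bool)
open import Data.Bool.Properties using () renaming (_≟_ to _≟ᵇ_)
open import Data.Empty using (⊥-elim)
open import Data.Fin.Base using (Fin; zero; suc)
open import Data.Fin.Properties using () renaming (_≟_ to _≟ᶠ_)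
open import Data.Fin.Subset
  using (Subset; ∣_∣; inside; outside; _⊆_; _∉_; _─_; _-_; ⁅_⁆; ⊤)
  renaming (_∈_ to _∈ˢ_)
open import Data.Fin.Subset.Properties
  using (_∈?_; drop-∷-⊆; p─q⊆p; x∈p∧x∉q⇒x∈p─q; x∈p∧x≢y⇒x∈p-y; x∈⁅x⁆; x∈⁅y⁆⇒x≡y;
    ∣⁅x⁆∣≡1; nonempty?; Empty-unique; ∣⊥∣≡0; ∣⊤∣≡n; ∈⊤; ∣p∣≤n; x∈p⇒∣p-x∣<∣p∣; p⊆q⇒∣p∣≤∣q∣)
open import Data.Integer.Base as ℤ using ()
import Data.Integer.Properties as ℤₚ
open import Data.List.Base
  using (List; []; _∷_; map; _++_; filter; length; upTo; allFin; cartesianProductWith)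
open import Data.List.Extrema.Nat using (xs≤max)
open import Data.List.Membership.Propositional using (_∈_)
open import Data.List.Membership.Propositional.Properties
  using (∈-cartesianProductWith⁻; ∈-upTo⁻; ∈-map⁺; ∈-map⁻; ∈-filter⁺; ∈-filter⁻;
    ∈-deduplicate⁺; ∈-deduplicate⁻; ∈-allFin)
open import Data.List.Properties using (length-upTo; length-map)
open import Data.List.Relation.Unary.All as All using (All; []; _∷_)
import Data.List.Relation.Unary.All.Properties as All
open import Data.List.Relation.Unary.AllPairs using (AllPairs; []; _∷_)
import Data.List.Relation.Unary.AllPairs.Properties as AllPairs
open import Data.List.Relation.Unary.Any using (here; there)
open import Data.List.Relation.Unary.Unique.Propositional using (Unique)
import Data.List.Relation.Unary.Unique.Propositional.Properties as Unique
open import Data.Nat.Base as ℕ using (ℕ; zero; suc; s≤s; z≤n; _+_; _*_; _^_; _≤_; _<_)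
open import Data.Nat.ListAction using (sum)
import Data.Nat.Properties as ℕₚ
open import Data.Nat.Solver using () renaming (module +-*-Solver to ℕ-Solver)
open import Data.Product.Base using (_×_; _,_; proj₁; proj₂; ∃-syntax)
open import Data.Rational.Base as ℚ using (ℚ; 0ℚ; 1ℚ; mkℚ)
import Data.Rational.Properties as ℚₚ
open import Data.Rational.Solver using (module +-*-Solver)
open import Data.Rational.Unnormalised.Base as ℚᵘ using (mkℚᵘ)
import Data.Rational.Unnormalised.Properties as ℚᵘₚ
open import Data.Sum.Base using (_⊎_; inj₁; inj₂)
open import Data.Vec.Base using (Vec; []; _∷_; lookup; here; there)
open import Data.Vec.Properties using (tabulate∘lookup; tabulate-cong; ∷-injective; ≡-dec)
open import Function.Base using (_∘_)
open import Function.Bundles using (_⇔_; Equivalence)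
open import Level using (0ℓ)
open import Relation.Binary.Bundles using (Preorder)
open import Relation.Binary.PropositionalEquality
  using (_≡_; refl; sym; trans; cong; cong₂; subst; subst₂; module ≡-Reasoning)
open import Relation.Nullary.Decidable using (yes; no; _×-dec_)
open import Relation.Nullary.Negation using (¬_; contradiction)

-- The equation for τ says that `x ↦ ϕ_E(x)/x` has derivative 0 at τ, and there its value is γ. This
-- is the origin of the constant: the induction closes whenever `N x ≥ s ϕ_E(x)` for some `x > 0`,
-- and τ is the stationary choice of `x`.
--
-- All counts are of colorings of the whole of V, so a vertex outside S is merely free. Hence
-- goodness for different S is compared inside one finite list, and hits on Z are counted by
-- recoloring `Z ─ K` in all ways, a double count within that list.
--
-- The exponent `l - 1` appears because v itself lies in `Z ─ K` and is already absent from S - v. A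
-- vertex of `Z ─ K` that is not in S may be charged the factor `N τ / s` as well, since
-- `N τ ≥ s ϕ_E(τ) ≥ s`.
--
-- Inequalities between reals hold only up to every ε in the limit. Quotients are therefore cleared
-- by multiplication and cancelled at the end, which requires factors bounded away from 0. So
-- `s > 0` has to be secured beforehand: it rests on I being nonempty and on every `d m` being at
-- least 1.

private
  variable
    A B C : Set
    n N : ℕ

-- Rational sequences, compared in the limit

Eventually : (ℕ → Set) → Set
Eventually P = ∃[ N ] (∀ n → N ℕ.≤ n → P n)

eventually-zip : ∀ {P Q R : ℕ → Set} → (∀ n → P n → Q n → R n) →
  Eventually P → Eventually Q → Eventually R
eventually-zip h (M , p) (N , q) = M ℕ.⊔ N , λ n M⊔N≤n →
  h n (p n (ℕₚ.m⊔n≤o⇒m≤o M N M⊔N≤n)) (q n (ℕₚ.m⊔n≤o⇒n≤o M N M⊔N≤n))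

infix 4 _≼_ _≐_
infixr 8 _^ˢ_
infixl 7 _⊗_
infixl 6 _⊕_

-- The estimates are made on arbitrary rational sequences: unlike reals, these
-- carry no convergence proofs that Agda would have to compare.
Seq : Set
Seq = ℕ → ℚ

-- The condition of `≤ℝ` on bare sequences. Being a record, it lets unification recover `x` and `y`
-- from its type; likewise for `_≐_`, which is equality term by term, so that algebraic identities
-- fall to the ring solver.
record _≼_ (x y : Seq) : Set where
  constructor mk≼
  field un≼ : ∀ ε → 0ℚ ℚ.< ε → Eventually (λ n → x n ℚ.≤ y n ℚ.+ ε)

record _≐_ (x y : Seq) : Set where
  constructor mk≐
  field un≐ : ∀ n → x n ≡ y n

Bounded : Seq → Set
Bounded x = ∃[ A ] ℚ.Positive A × Eventually (λ n → ℚ.∣ x n ∣ ℚ.≤ A)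

-- The two fields serve opposite directions: multiplying an inequality magnifies its error ε, which
-- an upper bound controls, and cancelling a factor magnifies it too, which a lower bound controls.
record Pos (x : Seq) : Set where
  constructor mkPos
  field
    lower     : ∃[ ε ] 0ℚ ℚ.< ε × Eventually (λ n → ε ℚ.≤ x n)
    isBounded : Bounded x

ι : ℕ → ℚ
ι n = ℤ.+ n ℚ./ 1

ν : ℕ → Seq
ν n _ = ι n

_⊕_ _⊗_ : Seq → Seq → Seq
(x ⊕ y) n = x n ℚ.+ y n
(x ⊗ y) n = x n ℚ.* y n

_^ˢ_ : Seq → ℕ → Seq
x ^ˢ zero  = ν 1
x ^ˢ suc e = x ⊗ x ^ˢ e

open _≼_
open _≐_
open Pos

private
  variable
    c w x y z τ : Seq

p≤p+ε : ∀ p {ε} → 0ℚ ℚ.< ε → p ℚ.≤ p ℚ.+ ε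
p≤p+ε p {ε} 0<ε = subst (ℚ._≤ p ℚ.+ ε) (ℚₚ.+-identityʳ p) (ℚₚ.+-monoʳ-≤ p (ℚₚ.<⇒≤ 0<ε))

pointwise-≼ : (∀ n → x n ℚ.≤ y n) → x ≼ y
pointwise-≼ h = mk≼ λ ε 0<ε → 0 , λ n _ → ℚₚ.≤-trans (h n) (p≤p+ε _ 0<ε)

≐⇒≼ : x ≐ y → x ≼ y
≐⇒≼ e = pointwise-≼ λ n → ℚₚ.≤-reflexive (un≐ e n)

≐-refl : x ≐ x
≐-refl = mk≐ λ _ → refl

≐-sym : x ≐ y → y ≐ x
≐-sym e = mk≐ λ n → sym (un≐ e n)

≐-trans : x ≐ y → y ≐ z → x ≐ z
≐-trans e f = mk≐ λ n → trans (un≐ e n) (un≐ f n)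

≼-trans : x ≼ y → y ≼ z → x ≼ z
≼-trans {x} {y} {z} p q = mk≼ λ ε 0<ε →
  let h , 0<h , h+h≡ε = half ε 0<ε in
  eventually-zip (λ n a b → begin
      x n                    ≤⟨ a ⟩
      y n ℚ.+ h              ≤⟨ ℚₚ.+-monoˡ-≤ h b ⟩
      z n ℚ.+ h ℚ.+ h        ≡⟨ ℚₚ.+-assoc (z n) h h ⟩
      z n ℚ.+ (h ℚ.+ h)      ≡⟨ cong (z n ℚ.+_) h+h≡ε ⟩
      z n ℚ.+ ε              ∎)
    (un≼ p h 0<h) (un≼ q h 0<h)
  where open ℚₚ.≤-Reasoning

≼-preorder : Preorder 0ℓ 0ℓ 0ℓ
≼-preorder = record
  { Carrier = Seq ; _≈_ = _≐_ ; _≲_ = _≼_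
  ; isPreorder = record
    { isEquivalence = record { refl = ≐-refl ; sym = ≐-sym ; trans = ≐-trans }
    ; reflexive = ≐⇒≼ ; trans = ≼-trans } }

module ≼-Reasoning where
  open import Relation.Binary.Reasoning.Preorder ≼-preorder public

≼-refl : x ≼ x
≼-refl = ≐⇒≼ ≐-refl

≼-reflexive : x ≡ y → x ≼ y
≼-reflexive refl = ≼-refl

+-mono-≼ : w ≼ x → y ≼ z → w ⊕ y ≼ x ⊕ z
+-mono-≼ {w} {x} {y} {z} p q = mk≼ λ ε 0<ε →
  let h , 0<h , h+h≡ε = half ε 0<ε in
  eventually-zip (λ n a b → subst (w n ℚ.+ y n ℚ.≤_)
      (trans (+-interchange (x n) (z n) h) (cong (x n ℚ.+ z n ℚ.+_) h+h≡ε))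
      (ℚₚ.+-mono-≤ a b))
    (un≼ p h 0<h) (un≼ q h 0<h)

+-cancelʳ-≼ : x ⊕ z ≼ y ⊕ z → x ≼ y
+-cancelʳ-≼ {x} {z} {y} p = mk≼ λ ε 0<ε →
  let N , h = un≼ p ε 0<ε in N , λ n N≤n →
  subst₂ ℚ._≤_ (cancelˡ (x n) (z n)) (cancelʳ (y n) (z n) ε)
    (ℚₚ.+-monoˡ-≤ (ℚ.- z n) (h n N≤n))
  where
  open +-*-Solver
  cancelˡ : ∀ a c → a ℚ.+ c ℚ.- c ≡ a
  cancelˡ = solve 2 (λ a c → a :+ c :- c := a) refl
  cancelʳ : ∀ b c e → b ℚ.+ c ℚ.+ e ℚ.- c ≡ b ℚ.+ e
  cancelʳ = solve 3 (λ b c e → b :+ c :+ e :- c := b :+ e) refl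

*-pos : ∀ {p q} → 0ℚ ℚ.< p → 0ℚ ℚ.< q → 0ℚ ℚ.< p ℚ.* q
*-pos {p} {q} 0<p 0<q = ℚₚ.positive⁻¹ (p ℚ.* q)
  {{ℚₚ.pos*pos⇒pos p {{ℚ.positive 0<p}} q {{ℚ.positive 0<q}}}}

*-monoˡ-≤ : ∀ p {q r} → 0ℚ ℚ.≤ p → q ℚ.≤ r → p ℚ.* q ℚ.≤ p ℚ.* r
*-monoˡ-≤ p 0≤p = ℚₚ.*-monoˡ-≤-nonNeg p {{ℚ.nonNegative 0≤p}}

*-monoʳ-≤ : ∀ p {q r} → 0ℚ ℚ.≤ p → q ℚ.≤ r → q ℚ.* p ℚ.≤ r ℚ.* p
*-monoʳ-≤ p 0≤p = ℚₚ.*-monoʳ-≤-nonNeg p {{ℚ.nonNegative 0≤p}}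

*-mono-≤ : ∀ {p q r s} → 0ℚ ℚ.≤ p → 0ℚ ℚ.≤ s → p ℚ.≤ q → r ℚ.≤ s → p ℚ.* r ℚ.≤ q ℚ.* s
*-mono-≤ {p} {s = s} 0≤p 0≤s p≤q r≤s = ℚₚ.≤-trans (*-monoˡ-≤ p 0≤p r≤s) (*-monoʳ-≤ s 0≤s p≤q)

*-monoˡ-≼ : Pos z → x ≼ y → z ⊗ x ≼ z ⊗ y
*-monoˡ-≼ {z} {x} {y} pz p = mk≼ λ ε 0<ε →
  let A , posA , z≤A = isBounded pz
      δ , 0<δ , Aδ+δA≡ε = portion A A ε posA posA 0<ε
      η , 0<η , z≥η = lower pz
  in eventually-zip (λ n (x≤ , η≤) ∣z∣≤A → begin
      z n ℚ.* x n
        ≤⟨ *-monoˡ-≤ (z n) (ℚₚ.≤-trans (ℚₚ.<⇒≤ 0<η) η≤) x≤ ⟩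
      z n ℚ.* (y n ℚ.+ δ)
        ≡⟨ ℚₚ.*-distribˡ-+ (z n) (y n) δ ⟩
      z n ℚ.* y n ℚ.+ z n ℚ.* δ
        ≤⟨ ℚₚ.+-monoʳ-≤ (z n ℚ.* y n) (begin
             z n ℚ.* δ       ≤⟨ *-monoʳ-≤ δ (ℚₚ.<⇒≤ 0<δ) (ℚₚ.≤-trans (p≤∣p∣ (z n)) ∣z∣≤A) ⟩
             A ℚ.* δ             ≤⟨ p≤p+ε (A ℚ.* δ) (*-pos 0<δ (ℚₚ.positive⁻¹ A {{posA}})) ⟩
             A ℚ.* δ ℚ.+ δ ℚ.* A ≡⟨ Aδ+δA≡ε ⟩
             ε ∎) ⟩
      z n ℚ.* y n ℚ.+ ε ∎)
    (eventually-zip (λ _ → _,_) (un≼ p δ 0<δ) z≥η) z≤A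
  where open ℚₚ.≤-Reasoning

*-cancelˡ-≼ : Pos z → z ⊗ x ≼ z ⊗ y → x ≼ y
*-cancelˡ-≼ {z} {x} {y} pz p = mk≼ λ ε 0<ε →
  let η , 0<η , z≥η = lower pz
  in eventually-zip (λ n zx≤ η≤z →
      ℚₚ.*-cancelˡ-≤-pos (z n) {{ℚ.positive (ℚₚ.<-≤-trans 0<η η≤z)}} (begin
        z n ℚ.* x n                     ≤⟨ zx≤ ⟩
        z n ℚ.* y n ℚ.+ η ℚ.* ε
          ≤⟨ ℚₚ.+-monoʳ-≤ (z n ℚ.* y n) (*-monoʳ-≤ ε (ℚₚ.<⇒≤ 0<ε) η≤z) ⟩
        z n ℚ.* y n ℚ.+ z n ℚ.* ε   ≡⟨ ℚₚ.*-distribˡ-+ (z n) (y n) ε ⟨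
        z n ℚ.* (y n ℚ.+ ε)             ∎))
    (un≼ p (η ℚ.* ε) (*-pos 0<η 0<ε)) z≥η
  where open ℚₚ.≤-Reasoning

*-bounded : Bounded x → Bounded y → Bounded (x ⊗ y)
*-bounded {x} {y} (A , posA , x≤A) (B , posB , y≤B) =
  A ℚ.* B , ℚₚ.pos*pos⇒pos A {{posA}} B {{posB}} ,
  eventually-zip (λ n a b → subst (ℚ._≤ A ℚ.* B) (sym (ℚₚ.∣p*q∣≡∣p∣*∣q∣ (x n) (y n)))
    (*-mono-≤ (ℚₚ.0≤∣p∣ (x n)) (ℚₚ.<⇒≤ (ℚₚ.positive⁻¹ B {{posB}})) a b)) x≤A y≤B

*-Pos : Pos x → Pos y → Pos (x ⊗ y)
*-Pos px py =
  let η , 0<η , x≥η = lower px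
      ζ , 0<ζ , y≥ζ = lower py
  in mkPos (η ℚ.* ζ , *-pos 0<η 0<ζ , eventually-zip (λ n a b →
       *-mono-≤ (ℚₚ.<⇒≤ 0<η) (ℚₚ.≤-trans (ℚₚ.<⇒≤ 0<ζ) b) a b) x≥η y≥ζ)
     (*-bounded (isBounded px) (isBounded py))

-- Half of the lower bound of `x` survives when the other half pays for the error in `x ≼ y`.
Pos-≼ : Pos x → Bounded y → x ≼ y → Pos y
Pos-≼ {x} {y} px by x≼y =
  let η , 0<η , x≥η = lower px
      h , 0<h , h+h≡η = half η 0<η
  in mkPos (h , 0<h , eventually-zip (λ n a b →
       subst₂ ℚ._≤_ (cancel h h) (cancelʳ (y n) h)
         (ℚₚ.+-monoˡ-≤ (ℚ.- h) (subst (ℚ._≤ y n ℚ.+ h) (sym h+h≡η) (ℚₚ.≤-trans a b))))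
       x≥η (un≼ x≼y h 0<h)) by
  where
  open +-*-Solver
  cancelʳ : ∀ a h → a ℚ.+ h ℚ.- h ≡ a
  cancelʳ = solve 2 (λ a h → a :+ h :- h := a) refl

-- Natural numbers as constant sequences, and powers

ι-suc : ∀ n → ι (suc n) ≡ 1ℚ ℚ.+ ι n
ι-suc n = trans (suc-/ n 0) (ℚₚ.+-comm (ι n) 1ℚ)

ι-+ : ∀ m n → ι (m ℕ.+ n) ≡ ι m ℚ.+ ι n
ι-+ zero    n = sym (ℚₚ.+-identityˡ (ι n))
ι-+ (suc m) n = trans (ι-suc (m ℕ.+ n)) (trans (cong (1ℚ ℚ.+_) (ι-+ m n))
  (trans (sym (ℚₚ.+-assoc 1ℚ (ι m) (ι n))) (cong (ℚ._+ ι n) (sym (ι-suc m)))))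

ι-* : ∀ m n → ι (m ℕ.* n) ≡ ι m ℚ.* ι n
ι-* zero    n = sym (ℚₚ.*-zeroˡ (ι n))
ι-* (suc m) n = begin
  ι (n ℕ.+ m ℕ.* n)            ≡⟨ ι-+ n (m ℕ.* n) ⟩
  ι n ℚ.+ ι (m ℕ.* n)          ≡⟨ cong (ι n ℚ.+_) (ι-* m n) ⟩
  ι n ℚ.+ ι m ℚ.* ι n          ≡⟨ solve 2 (λ a b → b :+ a :* b := (con 1ℚ :+ a) :* b) refl (ι m) (ι n) ⟩
  (1ℚ ℚ.+ ι m) ℚ.* ι n         ≡⟨ cong (ℚ._* ι n) (ι-suc m) ⟨
  ι (suc m) ℚ.* ι n            ∎
  where
  open ≡-Reasoning
  open +-*-Solver

ι-nonNeg : ∀ n → 0ℚ ℚ.≤ ι n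
ι-nonNeg n = ℚₚ.nonNegative⁻¹ (ι n) {{ℚₚ.normalize-nonNeg n 1}}

ι-pos : ∀ n .{{_ : ℕ.NonZero n}} → ℚ.Positive (ι n)
ι-pos n = ℚₚ.normalize-pos n 1

ι-mono-≤ : ∀ {m n} → m ℕ.≤ n → ι m ℚ.≤ ι n
ι-mono-≤ {m} {n} m≤n = subst (λ k → ι m ℚ.≤ ι k) (ℕₚ.m+[n∸m]≡n m≤n)
  (subst (ι m ℚ.≤_) (sym (ι-+ m (n ℕ.∸ m)))
    (subst (ℚ._≤ ι m ℚ.+ ι (n ℕ.∸ m)) (ℚₚ.+-identityʳ (ι m))
      (ℚₚ.+-monoʳ-≤ (ι m) (ι-nonNeg (n ℕ.∸ m)))))

ν-bounded : ∀ n → Bounded (ν n)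
ν-bounded n = ι (suc n) , ι-pos (suc n) , 0 , λ _ _ →
  subst (ℚ._≤ ι (suc n)) (sym (ℚₚ.0≤p⇒∣p∣≡p (ι-nonNeg n))) (ι-mono-≤ (ℕₚ.n≤1+n n))

ν-Pos : ∀ n → 0 ℕ.< n → Pos (ν n)
ν-Pos n 0<n = mkPos (1ℚ , 0<1 , 0 , λ _ _ → ι-mono-≤ 0<n) (ν-bounded n)

Pos⇒¬≼0 : Pos x → ¬ (x ≼ ν 0)
Pos⇒¬≼0 {x} px x≼0 =
  let η , 0<η , N , 0≥η = lower (Pos-≼ px (ν-bounded 0) x≼0)
  in ℚₚ.<-irrefl refl (ℚₚ.<-≤-trans 0<η (0≥η N ℕₚ.≤-refl))

^-Pos : Pos x → ∀ n → Pos (x ^ˢ n)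
^-Pos px zero    = ν-Pos 1 (s≤s z≤n)
^-Pos px (suc n) = *-Pos px (^-Pos px n)

*-comm-≐ : ∀ x y → x ⊗ y ≐ y ⊗ x
*-comm-≐ x y = mk≐ λ n → ℚₚ.*-comm (x n) (y n)

*-congˡ-≐ : ∀ z → x ≐ y → z ⊗ x ≐ z ⊗ y
*-congˡ-≐ z e = mk≐ λ n → cong (z n ℚ.*_) (un≐ e n)

*-monoʳ-≼ : Pos z → x ≼ y → x ⊗ z ≼ y ⊗ z
*-monoʳ-≼ {z} {x} {y} pz x≼y = begin
  x ⊗ z ≈⟨ *-comm-≐ x z ⟩
  z ⊗ x ≲⟨ *-monoˡ-≼ pz x≼y ⟩
  z ⊗ y ≈⟨ *-comm-≐ z y ⟩
  y ⊗ z ∎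
  where open ≼-Reasoning

^-mono-≼ : Pos x → Bounded y → x ≼ y → ∀ n → x ^ˢ n ≼ y ^ˢ n
^-mono-≼ px by x≼y zero    = ≼-refl
^-mono-≼ px by x≼y (suc n) = ≼-trans (*-monoʳ-≼ (^-Pos px n) x≼y)
  (*-monoˡ-≼ (Pos-≼ px by x≼y) (^-mono-≼ px by x≼y n))

^-distrib-*-≐ : ∀ x y n → (x ⊗ y) ^ˢ n ≐ x ^ˢ n ⊗ y ^ˢ n
^-distrib-*-≐ x y zero    = mk≐ λ _ → refl
^-distrib-*-≐ x y (suc n) = mk≐ λ k → trans
  (cong (x k ℚ.* y k ℚ.*_) (un≐ (^-distrib-*-≐ x y n) k))
  (swap (x k) (y k) ((x ^ˢ n) k) ((y ^ˢ n) k))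
  where
  open +-*-Solver
  swap : ∀ a b c d → a ℚ.* b ℚ.* (c ℚ.* d) ≡ a ℚ.* c ℚ.* (b ℚ.* d)
  swap = solve 4 (λ a b c d → a :* b :* (c :* d) := a :* c :* (b :* d)) refl

ν-mono : ∀ m n → m ℕ.≤ n → ν m ≼ ν n
ν-mono m n m≤n = pointwise-≼ λ _ → ι-mono-≤ m≤n

ν-* : ∀ m n → ν (m ℕ.* n) ≐ ν m ⊗ ν n
ν-* m n = mk≐ λ _ → ι-* m n

ν-^ : ∀ m n → ν (m ℕ.^ n) ≐ ν m ^ˢ n
ν-^ m zero    = ≐-refl
ν-^ m (suc n) = ≐-trans (ν-* m (m ℕ.^ n)) (*-congˡ-≐ (ν m) (ν-^ m n))

*-zeroˡ-≐ : ∀ x → ν 0 ⊗ x ≐ ν 0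
*-zeroˡ-≐ x = mk≐ λ n → ℚₚ.*-zeroˡ (x n)

*-zeroʳ-≐ : ∀ x → x ⊗ ν 0 ≐ ν 0
*-zeroʳ-≐ x = mk≐ λ n → ℚₚ.*-zeroʳ (x n)

-- Counts of colorings may vanish and `ν 0` is not `Pos`, so the factor 0 is treated apart.
*-monoˡ-≼-ν : ∀ n → x ≼ y → ν n ⊗ x ≼ ν n ⊗ y
*-monoˡ-≼-ν {x} {y} zero _ =
  ≐⇒≼ (≐-trans (*-zeroˡ-≐ x) (≐-sym (*-zeroˡ-≐ y)))
*-monoˡ-≼-ν (suc n) x≼y = *-monoˡ-≼ (ν-Pos (suc n) (s≤s z≤n)) x≼y

*-monoʳ-≼-ν : ∀ n → x ≼ y → x ⊗ ν n ≼ y ⊗ ν n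
*-monoʳ-≼-ν {x} {y} n x≼y = begin
  x ⊗ ν n ≈⟨ *-comm-≐ x (ν n) ⟩
  ν n ⊗ x ≲⟨ *-monoˡ-≼-ν n x≼y ⟩
  ν n ⊗ y ≈⟨ *-comm-≐ (ν n) y ⟩
  y ⊗ ν n ∎
  where open ≼-Reasoning

0≼*ν : Pos x → ∀ n → ν 0 ≼ x ⊗ ν n
0≼*ν {x} px n = begin
  ν 0            ≈⟨ *-zeroʳ-≐ x ⟨
  x ⊗ ν 0       ≲⟨ *-monoˡ-≼ px (ν-mono 0 n z≤n) ⟩
  x ⊗ ν n  ∎
  where open ≼-Reasoning

-- Suprema and roots

sup-upper : ∀ {I i} (f : ℕ → ℝ) → i ∈ I → seq (f i) ≼ seq (sup I f)
sup-upper {j ∷ I} f (here refl) = pointwise-≼ λ n → ℚₚ.p≤p⊔q (seq (f j) n) (seq (sup I f) n)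
sup-upper {j ∷ I} f (there i∈I) = ≼-trans (sup-upper f i∈I)
  (pointwise-≼ λ n → ℚₚ.p≤q⊔p (seq (f j) n) (seq (sup I f) n))

/-*-cancel : ∀ q k → ℤ.+ q ℚ./ suc k ℚ.* ι (suc k) ≡ ι q
/-*-cancel q k = ℚₚ.toℚᵘ-injective
  (ℚᵘₚ.≃-trans (ℚₚ.toℚᵘ-homo-* (ℤ.+ q ℚ./ suc k) (ι (suc k)))
  (ℚᵘₚ.≃-trans (ℚᵘₚ.*-cong (ℚₚ.toℚᵘ-fromℚᵘ (mkℚᵘ (ℤ.+ q) k)) (ℚₚ.toℚᵘ-fromℚᵘ (mkℚᵘ (ℤ.+ suc k) 0)))
  (ℚᵘₚ.≃-trans (ℚᵘ.*≡* eq) (ℚᵘₚ.≃-sym (ℚₚ.toℚᵘ-fromℚᵘ (mkℚᵘ (ℤ.+ q) 0))))))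
  where
  eq : ℤ.+ q ℤ.* ℤ.+ suc k ℤ.* ℤ.+ 1 ≡ ℤ.+ q ℤ.* ℤ.+ suc (k ℕ.* 1)
  eq = trans (ℤₚ.*-identityʳ (ℤ.+ q ℤ.* ℤ.+ suc k)) (cong (λ j → ℤ.+ q ℤ.* ℤ.+ suc j) (sym (ℕₚ.*-identityʳ k)))

seq-bounded : ∀ x → Bounded (seq x)
seq-bounded x = let A , posA , N , x≤A = bounded (seq x) (cauchy x) in A , posA , N , x≤A

-- Clears the denominator of `(Q / K)^e`, so that comparing powers of rational approximations
-- becomes a comparison of natural numbers.
^-*-cancel : ∀ (x : Seq) k Q K → x k ℚ.* ι K ≡ ι Q →
  ∀ e → (x ^ˢ e) k ℚ.* ι (K ℕ.^ e) ≡ ι (Q ℕ.^ e)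
^-*-cancel x k Q K h zero    = refl
^-*-cancel x k Q K h (suc e) = begin
  x k ℚ.* X ℚ.* ι (K ℕ.* K ℕ.^ e)          ≡⟨ cong (x k ℚ.* X ℚ.*_) (ι-* K (K ℕ.^ e)) ⟩
  x k ℚ.* X ℚ.* (ι K ℚ.* ι (K ℕ.^ e))      ≡⟨ swap (x k) X (ι K) (ι (K ℕ.^ e)) ⟩
  x k ℚ.* ι K ℚ.* (X ℚ.* ι (K ℕ.^ e))      ≡⟨ cong₂ ℚ._*_ h (^-*-cancel x k Q K h e) ⟩
  ι Q ℚ.* ι (Q ℕ.^ e)                          ≡⟨ ι-* Q (Q ℕ.^ e) ⟨
  ι (Q ℕ.* Q ℕ.^ e)                            ∎
  where
  X = (x ^ˢ e) k
  open ≡-Reasoning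
  open +-*-Solver
  swap : ∀ a b c d → a ℚ.* b ℚ.* (c ℚ.* d) ≡ a ℚ.* c ℚ.* (b ℚ.* d)
  swap = solve 4 (λ a b c d → a :* b :* (c :* d) := a :* c :* (b :* d)) refl

-- From `K^L ≤ a K^L < (q + 1)^L` follows `K ≤ q`. This keeps roots away from 0, as comparing their
-- powers requires.
1≼root : ∀ l {a} → 1 ℕ.≤ a → ν 1 ≼ seq (root (suc l) a)
1≼root l {a} 1≤a = pointwise-≼ λ k →
  let K = suc k
      q = ⌊root⌋ (suc l) (a ℕ.* K ℕ.^ suc l)
      K≤q : K ℕ.≤ q
      K≤q = ℕ.s≤s⁻¹ (^-cancelʳ-< (suc l) (ℕₚ.≤-<-trans
        (ℕₚ.m≤n*m (K ℕ.^ suc l) a {{ℕ.>-nonZero 1≤a}})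
        (⌊root⌋-< l (a ℕ.* K ℕ.^ suc l))))
  in ℚₚ.*-cancelʳ-≤-pos (ι K) {{ι-pos K}}
       (subst₂ ℚ._≤_ (sym (ℚₚ.*-identityˡ (ι K))) (sym (/-*-cancel q k)) (ι-mono-≤ K≤q))

-- The rational approximations ⌊root⌋ / (k+1) lie below the root, but adding
-- 1 / (k+1) to them brings them above it without changing the limit.
ν≼root^ : ∀ l {a} → 1 ℕ.≤ a → ν a ≼ seq (root (suc l) a) ^ˢ suc l
ν≼root^ l {a} 1≤a = ≼-trans a≼upper^ (^-mono-≼ upper-Pos (seq-bounded (root (suc l) a)) upper≼root (suc l))
  where
  unit-cauchy : Cauchy (λ k → ℤ.+ 1 ℚ./ suc k)
  unit-cauchy = cauchy⁺ (λ k → ℤ.+ 1 ℚ./ suc k) λ ε 0<ε →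
    let N , h = archimedean ε 0<ε in N , λ m n N≤m _ → ℚₚ.<-≤-trans (h m N≤m)
      (subst (ℚ._≤ ℤ.+ 1 ℚ./ suc n ℚ.+ ε) (ℚₚ.+-identityˡ ε) (ℚₚ.+-monoˡ-≤ ε
        (ℚₚ.nonNegative⁻¹ (ℤ.+ 1 ℚ./ suc n) {{ℚₚ.normalize-nonNeg 1 (suc n)}})))

  upper : ℝ
  upper = root (suc l) a +ℝ mkℝ (λ k → ℤ.+ 1 ℚ./ suc k) unit-cauchy

  upper≼root : seq upper ≼ seq (root (suc l) a)
  upper≼root = mk≼ λ ε 0<ε → let N , h = archimedean ε 0<ε in
    N , λ k N≤k → ℚₚ.+-monoʳ-≤ (rootSeq (suc l) a k) (ℚₚ.<⇒≤ (h k N≤k))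

  upper-Pos : Pos (seq upper)
  upper-Pos = Pos-≼ (ν-Pos 1 (s≤s z≤n)) (seq-bounded upper) (≼-trans (1≼root l 1≤a) (pointwise-≼ λ k →
    p≤p+ε (rootSeq (suc l) a k) (ℚₚ.positive⁻¹ (ℤ.+ 1 ℚ./ suc k) {{ℚₚ.normalize-pos 1 (suc k)}})))

  a≼upper^ : ν a ≼ seq upper ^ˢ suc l
  a≼upper^ = pointwise-≼ λ k →
    let K = suc k
        L = suc l
        q = ⌊root⌋ L (a ℕ.* K ℕ.^ L)
        upper*K : seq upper k ℚ.* ι K ≡ ι (suc q)
        upper*K = trans (cong (ℚ._* ι K) (sym (suc-/ q k))) (/-*-cancel (suc q) k)
    in ℚₚ.*-cancelʳ-≤-pos (ι (K ℕ.^ L)) {{ι-pos (K ℕ.^ L) {{ℕₚ.m^n≢0 K L}}}}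
         (subst₂ ℚ._≤_ (ι-* a (K ℕ.^ L)) (sym (^-*-cancel (seq upper) k (suc q) K upper*K L))
           (ι-mono-≤ (ℕₚ.<⇒≤ (⌊root⌋-< l (a ℕ.* K ℕ.^ L)))))

-- Ceilings

≼-archimedean : Bounded x → ∃[ M ] (x ≼ ν M)
≼-archimedean {x} (A , _ , N , bound) =
  let M , A≤M = above A
  in M , mk≼ λ ε 0<ε → N , λ n N≤n → ℚₚ.≤-trans (ℚₚ.≤-trans (p≤∣p∣ (x n)) (bound n N≤n))
       (ℚₚ.≤-trans A≤M (p≤p+ε _ 0<ε))
  where
  above : ∀ q → ∃[ M ] (q ℚ.≤ ι M)
  above q@(mkℚ (ℤ.+ p) d _) = suc p , subst (ℚ._≤ ι (suc p)) (ℚₚ.fromℚᵘ-toℚᵘ q)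
    (ℚₚ.<⇒≤ (/-< p (suc p) d 0 (subst (ℕ._< suc p ℕ.* suc d) (sym (ℕₚ.*-identityʳ p))
      (ℕₚ.m≤m*n (suc p) (suc d)))))
  above (mkℚ (ℤ.-[1+ _ ]) _ _) = 0 , ℚ.*≤* ℤ.-≤+

module _ (em : ExcludedMiddle 0ℓ) where

  -- If a single late term exceeds `N + ε`, the Cauchy property makes all late terms exceed
  -- `N + ε/2`, which is a witness of `fromℕ N <ℝ x`. Without such a witness every late term is thus
  -- at most `N + ε`.
  ≰⇒fromℕ<ℝ : ∀ x N → ¬ (seq x ≼ ν N) → fromℕ N <ℝ x
  ≰⇒fromℕ<ℝ x N x≰N with em {fromℕ N <ℝ x}
  ... | yes N<x = N<x
  ... | no  N≮x = contradiction (mk≼ λ ε 0<ε →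
    let h , 0<h , h+h≡ε = half ε 0<ε
        M , close = cauchy⁻ (seq x) (cauchy x) h 0<h
    in M , λ n M≤n → ℚₚ.≮⇒≥ λ N+ε<xₙ → N≮x (h , 0<h , M , λ k M≤k →
      ℚₚ.<⇒≤ (subst₂ ℚ._<_ (cancel² (ι N) h) (cancel³ (seq x k) h)
        (ℚₚ.+-monoˡ-< (ℚ.- h) (ℚₚ.<-trans
          (subst (λ e → ι N ℚ.+ e ℚ.< seq x n) (sym h+h≡ε) N+ε<xₙ) (close n k M≤n M≤k))))))
    x≰N
    where
    open +-*-Solver
    cancel² : ∀ a h → a ℚ.+ (h ℚ.+ h) ℚ.- h ≡ a ℚ.+ h
    cancel² = solve 2 (λ a h → a :+ (h :+ h) :- h := a :+ h) refl
    cancel³ : ∀ a h → a ℚ.+ h ℚ.- h ≡ a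
    cancel³ = solve 2 (λ a h → a :+ h :- h := a) refl

  suc<ℝ : ∀ x N → fromℕ N <ℝ x → fromℕ (suc N) <ℝ x +ℝ 1ℝ
  suc<ℝ x N (ε , 0<ε , M , h) = ε , 0<ε , M , λ n M≤n →
    subst (ℚ._≤ seq x n ℚ.+ 1ℚ)
      (trans (solve 2 (λ a e → a :+ e :+ con 1ℚ := con 1ℚ :+ a :+ e) refl (ι N) ε)
        (cong (ℚ._+ ε) (sym (ι-suc N))))
      (ℚₚ.+-monoˡ-≤ 1ℚ (h n M≤n))
    where open +-*-Solver

  -- A descent from an integer upper bound, deciding each comparison by excluded middle; it stops
  -- where `M < x ≤ M + 1`, and the hypothesis prevents it from reaching 0.
  ceiling : ∀ x → ¬ (seq x ≼ ν 0) → ∃[ N ] IsCeiling x N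
  ceiling x x≰0 = let M , x≼M = ≼-archimedean (seq-bounded x) in go M x≼M
    where
    go : ∀ M → seq x ≼ ν M → ∃[ N ] IsCeiling x N
    go zero    x≼0 = contradiction x≼0 x≰0
    go (suc M) x≼1+M with em {seq x ≼ ν M}
    ... | yes x≼M = go M x≼M
    ... | no  x≰M = suc M , un≼ x≼1+M , suc<ℝ x M (≰⇒fromℕ<ℝ x M x≰M)

-- Sums over lists

∑ : (A → ℕ) → List A → ℕ
∑ φ xs = sum (map φ xs)

∑-++ : ∀ (φ : A → ℕ) xs ys → ∑ φ (xs ++ ys) ≡ ∑ φ xs + ∑ φ ys
∑-++ φ []       ys = refl
∑-++ φ (x ∷ xs) ys = trans (cong (φ x +_) (∑-++ φ xs ys)) (sym (ℕₚ.+-assoc (φ x) _ _))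

∑-mono : ∀ {φ ψ : A → ℕ} xs → (∀ {x} → x ∈ xs → φ x ≤ ψ x) → ∑ φ xs ≤ ∑ ψ xs
∑-mono []       h = z≤n
∑-mono (x ∷ xs) h = ℕₚ.+-mono-≤ (h (here refl)) (∑-mono xs (h ∘ there))

∑-cong : ∀ {φ ψ : A → ℕ} xs → (∀ x → φ x ≡ ψ x) → ∑ φ xs ≡ ∑ ψ xs
∑-cong []       h = refl
∑-cong (x ∷ xs) h = cong₂ _+_ (h x) (∑-cong xs h)

∑-*ˡ : ∀ c (φ : A → ℕ) xs → ∑ (λ x → c * φ x) xs ≡ c * ∑ φ xs
∑-*ˡ c φ []       = sym (ℕₚ.*-zeroʳ c)
∑-*ˡ c φ (x ∷ xs) = trans (cong (c * φ x +_) (∑-*ˡ c φ xs)) (sym (ℕₚ.*-distribˡ-+ c (φ x) _))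

∑-+ : ∀ (φ ψ : A → ℕ) xs → ∑ (λ x → φ x + ψ x) xs ≡ ∑ φ xs + ∑ ψ xs
∑-+ φ ψ []       = refl
∑-+ φ ψ (x ∷ xs) = trans (cong (φ x + ψ x +_) (∑-+ φ ψ xs)) (interchange⁺ (φ x) (ψ x) _ _)
  where
  open ℕ-Solver
  interchange⁺ : ∀ a b c d → a + b + (c + d) ≡ a + c + (b + d)
  interchange⁺ = solve 4 (λ a b c d → a :+ b :+ (c :+ d) := a :+ c :+ (b :+ d)) refl

∑-const : ∀ c (xs : List A) → ∑ (λ _ → c) xs ≡ length xs * c
∑-const c []       = refl
∑-const c (x ∷ xs) = cong (c +_) (∑-const c xs)

∑-swap : ∀ (φ : A → B → ℕ) xs ys →
  ∑ (λ x → ∑ (φ x) ys) xs ≡ ∑ (λ y → ∑ (λ x → φ x y) xs) ys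
∑-swap φ []       ys = sym (trans (∑-const 0 ys) (ℕₚ.*-zeroʳ (length ys)))
∑-swap φ (x ∷ xs) ys = trans (cong (∑ (φ x) ys +_) (∑-swap φ xs ys))
  (sym (∑-+ (φ x) (λ y → ∑ (λ x → φ x y) xs) ys))

∑-map : ∀ (φ : B → ℕ) (f : A → B) xs → ∑ φ (map f xs) ≡ ∑ (φ ∘ f) xs
∑-map φ f []       = refl
∑-map φ f (x ∷ xs) = cong (φ (f x) +_) (∑-map φ f xs)

∑-cartesianProductWith : ∀ (φ : C → ℕ) (f : A → B → C) xs ys →
  ∑ φ (cartesianProductWith f xs ys) ≡ ∑ (λ x → ∑ (λ y → φ (f x y)) ys) xs
∑-cartesianProductWith φ f []       ys = refl
∑-cartesianProductWith φ f (x ∷ xs) ys = trans (∑-++ φ (map (f x) ys) _)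
  (cong₂ _+_ (∑-map φ (f x) ys) (∑-cartesianProductWith φ f xs ys))

∑-term : ∀ (φ : A → ℕ) {x xs} → x ∈ xs → φ x ≤ ∑ φ xs
∑-term φ {xs = y ∷ xs} (here refl)  = ℕₚ.m≤m+n (φ y) _
∑-term φ {xs = y ∷ xs} (there x∈xs) = ℕₚ.≤-trans (∑-term φ x∈xs) (ℕₚ.m≤n+m _ (φ y))

0<∑⇒∃ : ∀ (φ : A → ℕ) xs → 0 < ∑ φ xs → ∃[ x ] x ∈ xs × 0 < φ x
0<∑⇒∃ φ (x ∷ xs) h with φ x in eq
... | suc _ = x , here refl , subst (0 <_) (sym eq) (s≤s z≤n)
... | zero  = let y , y∈xs , 0<φy = 0<∑⇒∃ φ xs h in y , there y∈xs , 0<φy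

-- Subsets

x∈p─q⇒x∉q : ∀ {p q : Subset n} {x} → x ∈ˢ p ─ q → x ∉ q
x∈p─q⇒x∉q {p = inside  ∷ p} {outside ∷ q} here        ()
x∈p─q⇒x∉q {p = inside  ∷ p} {outside ∷ q} (there x∈) (there x∈q) = x∈p─q⇒x∉q x∈ x∈q
x∈p─q⇒x∉q {p = inside  ∷ p} {inside  ∷ q} (there x∈) (there x∈q) = x∈p─q⇒x∉q x∈ x∈q
x∈p─q⇒x∉q {p = outside ∷ p} {outside ∷ q} (there x∈) (there x∈q) = x∈p─q⇒x∉q x∈ x∈q
x∈p─q⇒x∉q {p = outside ∷ p} {inside  ∷ q} (there x∈) (there x∈q) = x∈p─q⇒x∉q x∈ x∈q

∣p─q∣+∣q∣≡∣p∣ : ∀ (p q : Subset n) → q ⊆ p → ∣ p ─ q ∣ + ∣ q ∣ ≡ ∣ p ∣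
∣p─q∣+∣q∣≡∣p∣ []            []            q⊆p = refl
∣p─q∣+∣q∣≡∣p∣ (outside ∷ p) (outside ∷ q) q⊆p = ∣p─q∣+∣q∣≡∣p∣ p q (drop-∷-⊆ q⊆p)
∣p─q∣+∣q∣≡∣p∣ (inside  ∷ p) (outside ∷ q) q⊆p = cong suc (∣p─q∣+∣q∣≡∣p∣ p q (drop-∷-⊆ q⊆p))
∣p─q∣+∣q∣≡∣p∣ (outside ∷ p) (inside  ∷ q) q⊆p = contradiction (q⊆p here) λ ()
∣p─q∣+∣q∣≡∣p∣ (inside  ∷ p) (inside  ∷ q) q⊆p =
  trans (ℕₚ.+-suc _ ∣ q ∣) (cong suc (∣p─q∣+∣q∣≡∣p∣ p q (drop-∷-⊆ q⊆p)))

∣p-x∣+1≡∣p∣ : ∀ {p : Subset n} {x} → x ∈ˢ p → suc ∣ p - x ∣ ≡ ∣ p ∣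
∣p-x∣+1≡∣p∣ {p = p} {x} x∈p = trans (ℕₚ.+-comm 1 ∣ p - x ∣)
  (trans (cong (∣ p - x ∣ +_) (sym (∣⁅x⁆∣≡1 x)))
    (∣p─q∣+∣q∣≡∣p∣ p ⁅ x ⁆ λ y∈ → subst (_∈ˢ p) (sym (x∈⁅y⁆⇒x≡y x y∈)) x∈p))

x∉p-x : ∀ {p : Subset n} {x} → x ∉ p - x
x∉p-x {x = x} x∈ = x∈p─q⇒x∉q x∈ (x∈⁅x⁆ x)

-- Colorings with N colors

colorings : ℕ → ∀ n → List (Vec ℕ n)
colorings N zero    = [] ∷ []
colorings N (suc n) = cartesianProductWith _∷_ (upTo N) (colorings N n)

choices : ℕ → Bool → ℕ → List ℕ
choices N inside  c = upTo N
choices N outside c = c ∷ []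

recolorings : ℕ → Subset n → Vec ℕ n → List (Vec ℕ n)
recolorings N []      []      = [] ∷ []
recolorings N (b ∷ R) (c ∷ f) =
  cartesianProductWith _∷_ (choices N b c) (recolorings N R f)

-- Being a recoloring on `R` is a symmetric relation on `colorings N n`, so each `g` arises from
-- exactly the `N ^ ∣ R ∣` colorings that agree with it outside `R`.
∑-recolorings : ∀ N (R : Subset n) (φ : Vec ℕ n → ℕ) →
  ∑ (λ f → ∑ φ (recolorings N R f)) (colorings N n) ≡ N ^ ∣ R ∣ * ∑ φ (colorings N n)
∑-recolorings N []      φ = refl
∑-recolorings {suc n} N (b ∷ R) φ = begin
  ∑ (λ f → ∑ φ (recolorings N (b ∷ R) f)) (colorings N (suc n))
    ≡⟨ ∑-cartesianProductWith (λ f → ∑ φ (recolorings N (b ∷ R) f)) _∷_ (upTo N) Φ ⟩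
  ∑ (λ x → ∑ (λ f → ∑ φ (cartesianProductWith _∷_ (choices N b x) (recolorings N R f))) Φ) (upTo N)
    ≡⟨ ∑-cong (upTo N) (λ x → trans
         (∑-cong Φ λ f → ∑-cartesianProductWith φ _∷_ (choices N b x) (recolorings N R f))
         (∑-swap (λ f c → ∑ (λ g → φ (c ∷ g)) (recolorings N R f)) Φ (choices N b x))) ⟩
  ∑ (λ x → ∑ (λ c → ∑ (λ f → ∑ (λ g → φ (c ∷ g)) (recolorings N R f)) Φ) (choices N b x)) (upTo N)
    ≡⟨ ∑-cong (upTo N) (λ x → trans
         (∑-cong (choices N b x) λ c → ∑-recolorings N R (λ g → φ (c ∷ g)))
         (∑-*ˡ (N ^ ∣ R ∣) ψ (choices N b x))) ⟩
  ∑ (λ x → N ^ ∣ R ∣ * ∑ ψ (choices N b x)) (upTo N)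
    ≡⟨ lemma b ⟩
  N ^ ∣ b ∷ R ∣ * ∑ ψ (upTo N)
    ≡⟨ cong (N ^ ∣ b ∷ R ∣ *_) (∑-cartesianProductWith φ _∷_ (upTo N) Φ) ⟨
  N ^ ∣ b ∷ R ∣ * ∑ φ (colorings N (suc n)) ∎
  where
  open ≡-Reasoning
  Φ = colorings N n
  ψ : ℕ → ℕ
  ψ c = ∑ (λ f → φ (c ∷ f)) Φ
  lemma : ∀ b → ∑ (λ x → N ^ ∣ R ∣ * ∑ ψ (choices N b x)) (upTo N) ≡ N ^ ∣ b ∷ R ∣ * ∑ ψ (upTo N)
  lemma outside = trans
    (∑-cong (upTo N) λ x → cong (N ^ ∣ R ∣ *_) (ℕₚ.+-identityʳ (ψ x)))
    (∑-*ˡ (N ^ ∣ R ∣) ψ (upTo N))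
  -- On a coordinate of `R` the summand does not depend on the old color, so summing over that color
  -- yields one more factor `N`.
  lemma inside  = trans (∑-const (N ^ ∣ R ∣ * ∑ ψ (upTo N)) (upTo N))
    (trans (cong (_* (N ^ ∣ R ∣ * ∑ ψ (upTo N))) (length-upTo N))
      (sym (ℕₚ.*-assoc N (N ^ ∣ R ∣) (∑ ψ (upTo N)))))

recolorings-agree : ∀ N (R : Subset n) f {g} → g ∈ recolorings N R f →
  ∀ v → v ∉ R → lookup g v ≡ lookup f v
recolorings-agree N (b ∷ R) (x ∷ f) g∈ v v∉R
  with ∈-cartesianProductWith⁻ _∷_ (choices N b x) (recolorings N R f) g∈
recolorings-agree N (outside ∷ R) (x ∷ f) g∈ zero v∉R
  | _ , _ , here refl , _ , refl = refl
recolorings-agree N (inside ∷ R) (x ∷ f) g∈ zero v∉R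
  | _ = contradiction here v∉R
recolorings-agree N (b ∷ R) (x ∷ f) g∈ (suc v) v∉R
  | _ , g , _ , g∈′ , refl = recolorings-agree N R f g∈′ v (v∉R ∘ there)

recolorings-unique : ∀ N (R : Subset n) f → Unique (recolorings N R f)
recolorings-unique N []      []      = [] ∷ []
recolorings-unique N (b ∷ R) (x ∷ f) =
  Unique.cartesianProductWith⁺ _∷_ ∷-injective (choices-unique b) (recolorings-unique N R f)
  where
  choices-unique : ∀ b → Unique (choices N b x)
  choices-unique inside  = Unique.upTo⁺ N
  choices-unique outside = [] ∷ []

colorings-< : ∀ N {g : Vec ℕ n} → g ∈ colorings N n → ∀ v → lookup g v < N
colorings-< {suc n} N g∈ v
  with ∈-cartesianProductWith⁻ _∷_ (upTo N) (colorings N n) g∈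
colorings-< N g∈ zero    | _ , _ , x∈ , _ , refl = ∈-upTo⁻ x∈
colorings-< N g∈ (suc v) | _ , _ , _ , f∈ , refl = colorings-< N f∈ v

length-colorings : ∀ N n → length (colorings N n) ≡ N ^ n
length-colorings N n = begin
  length (colorings N n)            ≡⟨ ℕₚ.*-identityʳ _ ⟨
  length (colorings N n) * 1        ≡⟨ ∑-const 1 (colorings N n) ⟨
  ∑ (λ _ → 1) (colorings N n)       ≡⟨ lemma n ⟩
  N ^ n                             ∎
  where
  open ≡-Reasoning
  lemma : ∀ n → ∑ (λ _ → 1) (colorings N n) ≡ N ^ n
  lemma zero    = refl
  lemma (suc n) = begin
    ∑ (λ _ → 1) (colorings N (suc n))              ≡⟨ ∑-cartesianProductWith (λ _ → 1) _∷_ (upTo N) (colorings N n) ⟩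
    ∑ (λ _ → ∑ (λ _ → 1) (colorings N n)) (upTo N) ≡⟨ ∑-const (∑ (λ _ → 1) (colorings N n)) (upTo N) ⟩
    length (upTo N) * ∑ (λ _ → 1) (colorings N n)  ≡⟨ cong₂ _*_ (length-upTo N) (lemma n) ⟩
    N * N ^ n                                      ∎

lookup-injective : ∀ {f g : Vec ℕ n} → (∀ v → lookup f v ≡ lookup g v) → f ≡ g
lookup-injective {f = f} {g} h =
  trans (sym (tabulate∘lookup f)) (trans (tabulate-cong h) (tabulate∘lookup g))

AllPairs-map-All : ∀ {P : A → Set} {Q R : A → A → Set} {xs} →
  (∀ {x y} → P x → P y → Q x y → R x y) → All P xs → AllPairs Q xs → AllPairs R xs
AllPairs-map-All h []       []       = []
AllPairs-map-All h (p ∷ ps) (q ∷ qs) =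
  All.zipWith (λ (py , qxy) → h p py qxy) (ps , q) ∷ AllPairs-map-All h ps qs

-- Counting good colorings and hits

module Counting (em : ExcludedMiddle 0ℓ) (Bad : BadSettings n) where

  -- `Good` and `Hits` involve an arbitrary predicate `Bad`, so it takes excluded middle to count by
  -- them.
  𝟙 : Set → ℕ
  𝟙 P with em {P}
  ... | yes _ = 1
  ... | no  _ = 0

  𝟙-mono : ∀ {P Q : Set} → (P → Q) → 𝟙 P ≤ 𝟙 Q
  𝟙-mono {P} {Q} h with em {P} | em {Q}
  ... | yes _ | yes _ = s≤s z≤n
  ... | yes p | no ¬q = contradiction (h p) ¬q
  ... | no  _ | _     = z≤n

  𝟙-true : ∀ {P : Set} → P → 𝟙 P ≡ 1
  𝟙-true {P} p with em {P}
  ... | yes _ = refl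
  ... | no ¬p = contradiction p ¬p

  𝟙-pos : ∀ {P : Set} → 0 < 𝟙 P → P
  𝟙-pos {P} h with em {P}
  ... | yes p = p

  𝟙-× : ∀ {P Q : Set} → 𝟙 (P × Q) ≡ 𝟙 P * 𝟙 Q
  𝟙-× {P} {Q} with em {P} | em {Q}
  ... | yes p | yes q = 𝟙-true (p , q)
  ... | yes _ | no ¬q = ℕₚ.n≤0⇒n≡0 (ℕₚ.≮⇒≥ λ h → ¬q (proj₂ (𝟙-pos {P × Q} h)))
  ... | no ¬p | _     = ℕₚ.n≤0⇒n≡0 (ℕₚ.≮⇒≥ λ h → ¬p (proj₁ (𝟙-pos {P × Q} h)))

  ∑-𝟙 : ∀ (P : A → Set) xs → ∑ (λ x → 𝟙 (P x)) xs ≡ length (filter (λ x → em {P x}) xs)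
  ∑-𝟙 P []       = refl
  ∑-𝟙 P (x ∷ xs) with em {P x}
  ... | yes _ = cong suc (∑-𝟙 P xs)
  ... | no  _ = ∑-𝟙 P xs

  Good : Subset n → Vec ℕ n → Set
  Good S g = ∀ Y → Y ⊆ S → ∀ c → Bad Y c → ¬ (restrict (lookup g) Y ≋ c)

  Hits : Subset n → Vec ℕ n → Set
  Hits Y g = ∃[ c ] Bad Y c × restrict (lookup g) Y ≋ c

  Good-⊆ : ∀ {S T} g → S ⊆ T → Good T g → Good S g
  Good-⊆ g S⊆T good Y Y⊆S = good Y (S⊆T ∘ Y⊆S)

  Good-local : ∀ {S} f g → (∀ v → v ∈ˢ S → lookup f v ≡ lookup g v) → Good S f → Good S g
  Good-local f g agree good Y Y⊆S c bad g≋c =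
    good Y Y⊆S c bad λ v v∈Y → trans (agree v (Y⊆S v∈Y)) (g≋c v v∈Y)

  -- Recolorings on `Y ─ K` keep the values of `f` on `K`, so the bad colorings they hit all extend
  -- one coloring of `K`. They also coincide outside `Y`, so distinct recolorings hit bad colorings
  -- that differ on `Y`.
  ∑-Hits-recolorings : ∀ N {Y K m} → K ⊆ Y →
    ((κ : Coloring K) → AtMost m (λ c → Bad Y c × Extends c κ)) →
    ∀ f → ∑ (λ g → 𝟙 (Hits Y g)) (recolorings N (Y ─ K) f) ≤ m
  ∑-Hits-recolorings N {Y} {K} {m} K⊆Y atMost f = subst (_≤ m)
    (trans (length-map witness gs) (sym (∑-𝟙 (Hits Y) (recolorings N R f))))
    (atMost (restrict (lookup f) K) (map witness gs)
      (All.map⁺ (All.map (λ {g} (hit , agree) → witness-bad g hit , λ v v∈Y v∈K →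
        trans (sym (witness-≋ g v v∈Y)) (agree v λ v∈R → x∈p─q⇒x∉q v∈R v∈K)) props))
      (AllPairs.map⁺ (AllPairs-map-All (λ {g} {h} (_ , p) (_ , q) g≢h w≋w → g≢h
        (lookup-injective λ v → agree-everywhere g h p q w≋w v))
        props (Unique.filter⁺ (λ g → em {Hits Y g}) (recolorings-unique N R f)))))
    where
    R = Y ─ K
    gs = filter (λ g → em {Hits Y g}) (recolorings N R f)

    -- `Bad` is not assumed to respect `≋`, so the list handed to `atMost` consists of the bad
    -- colorings themselves instead of restrictions. The default value makes `witness-≋` hold for
    -- every `g`.
    witness : Vec ℕ n → Coloring Y
    witness g with em {Hits Y g}
    ... | yes (c , _) = c
    ... | no  _       = restrict (lookup g) Y

    witness-≋ : ∀ g → restrict (lookup g) Y ≋ witness g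
    witness-≋ g v v∈Y with em {Hits Y g}
    ... | yes (_ , _ , g≋c) = g≋c v v∈Y
    ... | no  _             = refl

    witness-bad : ∀ g → Hits Y g → Bad Y (witness g)
    witness-bad g hit with em {Hits Y g}
    ... | yes (_ , bad , _) = bad
    ... | no  ¬hit          = contradiction hit ¬hit

    Agrees : Vec ℕ n → Set
    Agrees g = ∀ v → v ∉ R → lookup g v ≡ lookup f v

    props : All (λ g → Hits Y g × Agrees g) gs
    props = All.tabulate λ g∈ →
      let g∈′ , hit = ∈-filter⁻ (λ g → em {Hits Y g}) {xs = recolorings N R f} g∈
      in hit , recolorings-agree N R f g∈′

    agree-everywhere : ∀ g h → Agrees g → Agrees h → witness g ≋ witness h →
      ∀ v → lookup g v ≡ lookup h v
    agree-everywhere g h p q w≋w v with v ∈? Y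
    ... | yes v∈Y = trans (witness-≋ g v v∈Y) (trans (w≋w v v∈Y) (sym (witness-≋ h v v∈Y)))
    ... | no  v∉Y = let v∉R = v∉Y ∘ p─q⊆p Y K in trans (p v v∉R) (sym (q v v∉R))

  module _ (N : ℕ) where

    #good : Subset n → ℕ
    #good S = ∑ (λ g → 𝟙 (Good S g)) (colorings N n)

    #hits : Subset n → Subset n → ℕ
    #hits S Y = ∑ (λ g → 𝟙 (Good S g × Hits Y g)) (colorings N n)

    -- Since `S′` lies in `S` and misses `Y ─ K`, any `f` with a recoloring that is good for `S` is
    -- itself good for `S′`, and at most `m` recolorings of `f` hit `Y`. Summing over `f` counts
    -- each hit `N ^ ∣ Y ─ K ∣` times.
    #hits-≤ : ∀ {S S′ Y K m} → K ⊆ Y →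
      ((κ : Coloring K) → AtMost m (λ c → Bad Y c × Extends c κ)) →
      S′ ⊆ S → (∀ v → v ∈ˢ S′ → v ∉ Y ─ K) →
      N ^ ∣ Y ─ K ∣ * #hits S Y ≤ m * #good S′
    #hits-≤ {S} {S′} {Y} {K} {m} K⊆Y atMost S′⊆S disjoint = begin
      N ^ ∣ R ∣ * #hits S Y
        ≡⟨ ∑-recolorings N R (λ g → 𝟙 (Good S g × Hits Y g)) ⟨
      ∑ (λ f → ∑ (λ g → 𝟙 (Good S g × Hits Y g)) (recolorings N R f)) Φ
        ≤⟨ ∑-mono Φ (λ {f} _ → begin
             ∑ (λ g → 𝟙 (Good S g × Hits Y g)) (recolorings N R f)
               ≤⟨ ∑-mono (recolorings N R f) (λ {g} g∈ → ℕₚ.≤-trans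
                    (𝟙-mono (λ (good , hit) → Good-local g f (λ v v∈S′ →
                      recolorings-agree N R f g∈ v (disjoint v v∈S′)) (Good-⊆ g S′⊆S good) , hit))
                    (ℕₚ.≤-reflexive 𝟙-×)) ⟩
             ∑ (λ g → 𝟙 (Good S′ f) * 𝟙 (Hits Y g)) (recolorings N R f)
               ≡⟨ ∑-*ˡ (𝟙 (Good S′ f)) (λ g → 𝟙 (Hits Y g)) (recolorings N R f) ⟩
             𝟙 (Good S′ f) * ∑ (λ g → 𝟙 (Hits Y g)) (recolorings N R f)
               ≤⟨ ℕₚ.*-monoʳ-≤ (𝟙 (Good S′ f)) (∑-Hits-recolorings N K⊆Y atMost f) ⟩
             𝟙 (Good S′ f) * m
               ≡⟨ ℕₚ.*-comm (𝟙 (Good S′ f)) m ⟩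
             m * 𝟙 (Good S′ f) ∎) ⟩
      ∑ (λ f → m * 𝟙 (Good S′ f)) Φ
        ≡⟨ ∑-*ˡ m (λ f → 𝟙 (Good S′ f)) Φ ⟩
      m * #good S′ ∎
      where
      open ℕₚ.≤-Reasoning
      R = Y ─ K
      Φ = colorings N n

    0<#good⇒∃ : ∀ S → 0 < #good S → ∃[ g ] (∀ v → lookup g v < N) × Good S g
    0<#good⇒∃ S h = let g , g∈ , good = 0<∑⇒∃ (λ g → 𝟙 (Good S g)) (colorings N n) h
                    in g , colorings-< N g∈ , 𝟙-pos good

    0<#good : 0 < N → ∀ S → (∀ g → Good S g) → 0 < #good S
    0<#good 0<N S good = subst (0 <_)
      (sym (trans (∑-cong (colorings N n) λ g → 𝟙-true (good g))
        (trans (∑-const 1 (colorings N n)) (trans (ℕₚ.*-identityʳ _) (length-colorings N n)))))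
      (ℕₚ.m^n>0 N {{ℕ.>-nonZero 0<N}} n)

    module _ {I : List ℕ} {Z : ℕ → Subset n} (k : ℕ → ℕ)
      (family : ∀ Y → (∃[ c ] Bad Y c) ⇔ (∃[ i ] i ∈ I × Z i ≡ Y)) where
      open Family I Z k

      ∈-Q⁺ : ∀ {i v} → i ∈ I → v ∈ˢ Z i → Z i ∈ Q (l i) v
      ∈-Q⁺ {i} {v} i∈I v∈ = ∈-deduplicate⁺ (≡-dec _≟ᵇ_)
        (∈-map⁺ Z (∈-filter⁺ (λ j → (v ∈? Z j) ×-dec (l j ℕₚ.≟ l i)) i∈I (v∈ , refl)))

      ∈-Q⁻ : ∀ {e v Y} → Y ∈ Q e v → ∃[ i ] i ∈ I × Z i ≡ Y × v ∈ˢ Z i × l i ≡ e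
      ∈-Q⁻ {e} {v} Y∈ =
        let P? = λ j → (v ∈? Z j) ×-dec (l j ℕₚ.≟ e)
            i , i∈ , Y≡ = ∈-map⁻ Z (∈-deduplicate⁻ (≡-dec _≟ᵇ_) (map Z (filter P? I)) Y∈)
            i∈I , v∈ , l≡ = ∈-filter⁻ P? {xs = I} i∈
        in i , i∈I , sym Y≡ , v∈ , l≡

      -- A union bound: a bad setting inside `T` that misses `v` already lies inside `S`, so a
      -- coloring good for `S` but not for `T` hits a set containing `v`, and that set is listed in
      -- `Q` under its own `l`.
      #good-≤ : ∀ {S T v} → (∀ {x} → x ∈ˢ T → x ∈ˢ S ⊎ x ≡ v) →
        #good S ≤ #good T + ∑ (λ e → ∑ (#hits S) (Q e v)) E
      #good-≤ {S} {T} {v} T⊆S∪v = begin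
        #good S
          ≤⟨ ∑-mono Φ (λ {g} _ → pointwise g) ⟩
        ∑ (λ g → 𝟙 (Good T g) + ∑ (λ e → ∑ (λ Y → 𝟙 (Good S g × Hits Y g)) (Q e v)) E) Φ
          ≡⟨ ∑-+ (λ g → 𝟙 (Good T g)) _ Φ ⟩
        #good T + ∑ (λ g → ∑ (λ e → ∑ (λ Y → 𝟙 (Good S g × Hits Y g)) (Q e v)) E) Φ
          ≡⟨ cong (#good T +_) (trans (∑-swap _ Φ E)
               (∑-cong E λ e → ∑-swap (λ g Y → 𝟙 (Good S g × Hits Y g)) Φ (Q e v))) ⟩
        #good T + ∑ (λ e → ∑ (#hits S) (Q e v)) E ∎
        where
        open ℕₚ.≤-Reasoning
        Φ = colorings N n
        F : Vec ℕ n → ℕ → ℕ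
        F g e = ∑ (λ Y → 𝟙 (Good S g × Hits Y g)) (Q e v)

        hit : ∀ g → Good S g → ¬ Good T g → 1 ≤ ∑ (F g) E
        hit g good ¬good with em {1 ≤ ∑ (F g) E}
        ... | yes p = p
        ... | no ¬p = ⊥-elim (¬good λ Y Y⊆T c bad g≋c →
          let i , i∈I , Zi≡Y = Equivalence.to (family Y) (c , bad) in
          unhit Y Y⊆T c bad g≋c i i∈I Zi≡Y)
          where
          unhit : ∀ Y → Y ⊆ T → ∀ c → Bad Y c → restrict (lookup g) Y ≋ c →
            ∀ i → i ∈ I → ¬ (Z i ≡ Y)
          unhit Y Y⊆T c bad g≋c i i∈I refl with v ∈? Y
          ... | yes v∈Y = ¬p (ℕₚ.≤-trans
            (ℕₚ.≤-trans (ℕₚ.≤-reflexive (sym (𝟙-true (good , c , bad , g≋c))))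
              (∑-term (λ Y → 𝟙 (Good S g × Hits Y g)) (∈-Q⁺ i∈I v∈Y)))
            (∑-term (F g) (∈-deduplicate⁺ ℕₚ._≟_ (∈-map⁺ l i∈I))))
          ... | no v∉Y = good Y (λ x∈Y → strip x∈Y (T⊆S∪v (Y⊆T x∈Y))) c bad g≋c
            where
            strip : ∀ {x} → x ∈ˢ Y → x ∈ˢ S ⊎ x ≡ v → x ∈ˢ S
            strip _   (inj₁ x∈S)  = x∈S
            strip x∈Y (inj₂ refl) = contradiction x∈Y v∉Y

        pointwise : ∀ g → 𝟙 (Good S g) ≤ 𝟙 (Good T g) + ∑ (F g) E
        pointwise g with em {Good S g} | em {Good T g}
        ... | no _     | _        = z≤n
        ... | yes _    | yes _    = s≤s z≤n
        ... | yes good | no ¬good = hit g good ¬good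

-- The induction

-- Here `r = l - 1`, and `G′` counts after removal of the `r` vertices other than `v`. Both sides
-- are multiplied by `(s N)^r`; of the `r + 1` factors `s` supplied by `d m ≤ s^l`, one remains
-- after cancellation.
per-set-bound : ∀ {s τ : Seq} r d m N B G G′ → Pos s → Pos τ → 0 ℕ.< N →
  ν (d ℕ.* m) ≼ s ^ˢ suc r →
  N ℕ.^ suc r ℕ.* B ℕ.≤ m ℕ.* G′ →
  s ^ˢ r ⊗ ν G′ ≼ (ν N ⊗ τ) ^ˢ r ⊗ ν G →
  ν (d ℕ.* (N ℕ.* B)) ≼ (s ⊗ τ ^ˢ r) ⊗ ν G
per-set-bound {s} {τ} r d m N B G G′ ps pτ 0<N dm≼ NB≤ sG′≼ =
  *-cancelˡ-≼ (*-Pos (^-Pos ps r) (^-Pos (ν-Pos N 0<N) r)) (begin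
    (s ^ˢ r ⊗ ν N ^ˢ r) ⊗ ν (d ℕ.* (N ℕ.* B))
      ≈⟨ mk≐ (λ k → trans (cong (λ p → (s ^ˢ r) k ℚ.* p ℚ.* ι (d ℕ.* (N ℕ.* B))) (sym (un≐ (ν-^ N r) k)))
           (trans (ℚₚ.*-assoc ((s ^ˢ r) k) (ι (N ℕ.^ r)) _)
             (cong ((s ^ˢ r) k ℚ.*_) (sym (ι-* (N ℕ.^ r) (d ℕ.* (N ℕ.* B))))))) ⟩
    s ^ˢ r ⊗ ν (N ℕ.^ r ℕ.* (d ℕ.* (N ℕ.* B)))
      ≲⟨ *-monoˡ-≼ (^-Pos ps r) (ν-mono _ _ nat) ⟩
    s ^ˢ r ⊗ ν (G′ ℕ.* (d ℕ.* m))
      ≈⟨ mk≐ (λ k → trans (cong ((s ^ˢ r) k ℚ.*_) (ι-* G′ (d ℕ.* m)))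
           (sym (ℚₚ.*-assoc ((s ^ˢ r) k) (ι G′) (ι (d ℕ.* m))))) ⟩
    (s ^ˢ r ⊗ ν G′) ⊗ ν (d ℕ.* m)
      ≲⟨ *-monoʳ-≼-ν (d ℕ.* m) sG′≼ ⟩
    ((ν N ⊗ τ) ^ˢ r ⊗ ν G) ⊗ ν (d ℕ.* m)
      ≈⟨ mk≐ (λ k → ℚₚ.*-assoc (((ν N ⊗ τ) ^ˢ r) k) (ι G) (ι (d ℕ.* m))) ⟩
    (ν N ⊗ τ) ^ˢ r ⊗ (ν G ⊗ ν (d ℕ.* m))
      ≲⟨ *-monoˡ-≼ (^-Pos (*-Pos (ν-Pos N 0<N) pτ) r) (*-monoˡ-≼-ν G dm≼) ⟩
    (ν N ⊗ τ) ^ˢ r ⊗ (ν G ⊗ s ^ˢ suc r)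
      ≈⟨ mk≐ (λ k → trans (cong (ℚ._* (ι G ℚ.* (s k ℚ.* (s ^ˢ r) k))) (un≐ (^-distrib-*-≐ (ν N) τ r) k))
           (rearrange ((ν N ^ˢ r) k) ((τ ^ˢ r) k) (ι G) (s k) ((s ^ˢ r) k))) ⟩
    (s ^ˢ r ⊗ ν N ^ˢ r) ⊗ ((s ⊗ τ ^ˢ r) ⊗ ν G) ∎)
  where
  open ≼-Reasoning
  rearrange : ∀ a t g s u → (a ℚ.* t) ℚ.* (g ℚ.* (s ℚ.* u)) ≡ (u ℚ.* a) ℚ.* ((s ℚ.* t) ℚ.* g)
  rearrange = solve 5 (λ a t g s u → (a :* t) :* (g :* (s :* u)) := (u :* a) :* ((s :* t) :* g)) refl
    where open +-*-Solver
  nat : N ℕ.^ r ℕ.* (d ℕ.* (N ℕ.* B)) ℕ.≤ G′ ℕ.* (d ℕ.* m)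
  nat = subst₂ ℕ._≤_
    (solve 4 (λ P d N B → d :* (N :* P :* B) := P :* (d :* (N :* B))) refl (N ℕ.^ r) d N B)
    (solve 3 (λ d m G → d :* (m :* G) := G :* (d :* m)) refl d m G′)
    (ℕₚ.*-monoʳ-≤ d NB≤)
    where open ℕ-Solver

-- The hypothesis says, without division, that each term is at most a `d`-th of the bound. A
-- nonempty list forces `d` to be positive, so that it can be cancelled.
∑-≼-average : ∀ (b : A → ℕ) d G xs → Pos x → length xs ℕ.≤ d →
  (∀ {y} → y ∈ xs → ν (d ℕ.* b y) ≼ x ⊗ ν G) → ν (∑ b xs) ≼ x ⊗ ν G
∑-≼-average b d       G []       px _    _ = 0≼*ν px G
∑-≼-average {x = x} b d@(suc _) G xs@(_ ∷ _) px ∣xs∣≤d h = *-cancelˡ-≼ (ν-Pos d (s≤s z≤n)) (begin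
  ν d ⊗ ν (∑ b xs)            ≈⟨ ν-* d (∑ b xs) ⟨
  ν (d ℕ.* ∑ b xs)            ≲⟨ total xs h ⟩
  x ⊗ ν (length xs ℕ.* G)     ≲⟨ *-monoˡ-≼ px (ν-mono _ _ (ℕₚ.*-monoˡ-≤ G ∣xs∣≤d)) ⟩
  x ⊗ ν (d ℕ.* G)             ≈⟨ mk≐ (λ k → trans (cong (x k ℚ.*_) (ι-* d G)) (swap (x k) (ι d) (ι G))) ⟩
  ν d ⊗ (x ⊗ ν G)             ∎)
  where
  open ≼-Reasoning
  swap : ∀ a b c → a ℚ.* (b ℚ.* c) ≡ b ℚ.* (a ℚ.* c)
  swap = solve 3 (λ a b c → a :* (b :* c) := b :* (a :* c)) refl
    where open +-*-Solver
  total : ∀ ys → (∀ {y} → y ∈ ys → ν (d ℕ.* b y) ≼ x ⊗ ν G) →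
    ν (d ℕ.* ∑ b ys) ≼ x ⊗ ν (length ys ℕ.* G)
  total []       _ = ≼-trans (≼-reflexive (cong ν (ℕₚ.*-zeroʳ d))) (0≼*ν px 0)
  total (y ∷ ys) h = begin
    ν (d ℕ.* (b y ℕ.+ ∑ b ys))
      ≈⟨ mk≐ (λ k → trans (cong ι (ℕₚ.*-distribˡ-+ d (b y) (∑ b ys))) (ι-+ (d ℕ.* b y) (d ℕ.* ∑ b ys))) ⟩
    ν (d ℕ.* b y) ⊕ ν (d ℕ.* ∑ b ys)
      ≲⟨ +-mono-≼ (h (here refl)) (total ys (h ∘ there)) ⟩
    x ⊗ ν G ⊕ x ⊗ ν (length ys ℕ.* G)
      ≈⟨ mk≐ (λ k → trans (sym (ℚₚ.*-distribˡ-+ (x k) (ι G) _))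
           (cong (x k ℚ.*_) (sym (ι-+ G (length ys ℕ.* G))))) ⟩
    x ⊗ ν (G ℕ.+ length ys ℕ.* G) ∎

-- This is `ϕ_E(τ) - 1`, the weight of the lost colorings; the remaining 1 is the weight of what
-- survives.
powers : List ℕ → Seq → Seq
powers []      τ = ν 0
powers (e ∷ E) τ = τ ^ˢ e ⊕ powers E τ

0≼powers : ∀ E → Pos τ → ν 0 ≼ powers E τ
0≼powers []      pτ = ≼-refl
0≼powers {τ} (e ∷ E) pτ = begin
  ν 0                                ≈⟨ mk≐ (λ _ → refl) ⟩
  ν 0 ⊕ ν 0                          ≲⟨ +-mono-≼ (Pos⇒0≼ (^-Pos pτ e)) (0≼powers E pτ) ⟩
  τ ^ˢ e ⊕ powers E τ                ∎
  where
  open ≼-Reasoning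
  Pos⇒0≼ : Pos x → ν 0 ≼ x
  Pos⇒0≼ {x} px = ≼-trans (0≼*ν px 1) (≐⇒≼ (mk≐ λ k → ℚₚ.*-identityʳ (x k)))

∑-≼-powers : ∀ {a : Seq} (b : ℕ → ℕ) E → (∀ {e} → e ∈ E → a ⊗ ν (b e) ≼ c ⊗ τ ^ˢ e) →
  a ⊗ ν (∑ b E) ≼ c ⊗ powers E τ
∑-≼-powers {c} {τ} {a} b []      h = ≐⇒≼ (≐-trans (*-zeroʳ-≐ a) (≐-sym (*-zeroʳ-≐ c)))
∑-≼-powers {c} {τ} {a} b (e ∷ E) h = begin
  a ⊗ ν (b e ℕ.+ ∑ b E)
    ≈⟨ mk≐ (λ k → trans (cong (a k ℚ.*_) (ι-+ (b e) (∑ b E))) (ℚₚ.*-distribˡ-+ (a k) (ι (b e)) (ι (∑ b E)))) ⟩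
  a ⊗ ν (b e) ⊕ a ⊗ ν (∑ b E)
    ≲⟨ +-mono-≼ (h (here refl)) (∑-≼-powers {c} {τ} {a} b E (h ∘ there)) ⟩
  c ⊗ τ ^ˢ e ⊕ c ⊗ powers E τ
    ≈⟨ mk≐ (λ k → sym (ℚₚ.*-distribˡ-+ (c k) ((τ ^ˢ e) k) (powers E τ k))) ⟩
  c ⊗ (τ ^ˢ e ⊕ powers E τ) ∎
  where open ≼-Reasoning

seq-^ : ∀ x e → seq (x ^ℝ e) ≐ seq x ^ˢ e
seq-^ x zero    = ≐-refl
seq-^ x (suc e) = *-congˡ-≐ (seq x) (seq-^ x e)

eval-ϕ : ∀ E τ → seq (eval (ϕ E) τ) ≐ ν 1 ⊕ powers E (seq τ)
eval-ϕ E τ = mk≐ λ k → cong (1ℚ ℚ.+_) (un≐ (monomials E) k)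
  where
  monomials : ∀ E → seq (eval (map (1 ,_) E) τ) ≐ powers E (seq τ)
  monomials []      = ≐-refl
  monomials (e ∷ E) = mk≐ λ k → cong₂ ℚ._+_
    (trans (ℚₚ.*-identityˡ (seq (τ ^ℝ e) k)) (un≐ (seq-^ τ e) k)) (un≐ (monomials E) k)

module _ {n : ℕ} (G : Subset n → ℕ) {a b : Seq} (pa : Pos a) (pb : Pos b) (b≼a : b ≼ a) where

  Step : Subset n → Set
  Step S = ∀ v → v ∈ˢ S → b ⊗ ν (G (S - v)) ≼ a ⊗ ν (G S)

  -- `Step` is applied once per vertex of `R`. All sets met are contained in `S`, so knowing `Step`
  -- up to size `j` suffices. In the application `b` is `s` and `a` is `N τ`.
  removal : ∀ j → (∀ S → ∣ S ∣ ℕ.≤ j → Step S) → ∀ k (R S : Subset n) → ∣ S ∣ ℕ.≤ j → ∣ R ∣ ≡ k →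
    ∃[ S′ ] S′ ⊆ S × (∀ v → v ∈ˢ S′ → v ∉ R) × b ^ˢ k ⊗ ν (G S′) ≼ a ^ˢ k ⊗ ν (G S)
  removal j step k R S ∣S∣≤j ∣R∣≡k with nonempty? R
  removal j step zero R S ∣S∣≤j ∣R∣≡k | no ∄ = S , (λ x∈S → x∈S) , (λ v _ v∈R → ∄ (v , v∈R)) , ≼-refl
  removal j step (suc k) R S ∣S∣≤j ∣R∣≡k | no ∄ =
    contradiction (trans (sym ∣R∣≡k) (trans (cong ∣_∣ (Empty-unique ∄)) (∣⊥∣≡0 n))) λ ()
  removal j step zero R S ∣S∣≤j ∣R∣≡k | yes (v , v∈R) =
    contradiction (trans (∣p-x∣+1≡∣p∣ v∈R) ∣R∣≡k) λ ()
  removal j step (suc k) R S ∣S∣≤j ∣R∣≡k | yes (v , v∈R) =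
    let S₁ , S₁⊆S , v∉S₁ , bound₁ = remove-v
        S′ , S′⊆S₁ , disjoint , bound = removal j step k (R - v) S₁
          (ℕₚ.≤-trans (p⊆q⇒∣p∣≤∣q∣ S₁⊆S) ∣S∣≤j) (ℕₚ.suc-injective (trans (∣p-x∣+1≡∣p∣ v∈R) ∣R∣≡k))
    in S′ , S₁⊆S ∘ S′⊆S₁
       , (λ w w∈S′ w∈R → disjoint w w∈S′ (x∈p∧x≢y⇒x∈p-y w∈R λ { refl → v∉S₁ (S′⊆S₁ w∈S′) }))
       , (begin
           b ^ˢ suc k ⊗ ν (G S′)         ≈⟨ mk≐ (λ i → ℚₚ.*-assoc (b i) ((b ^ˢ k) i) (ι (G S′))) ⟩
           b ⊗ (b ^ˢ k ⊗ ν (G S′))       ≲⟨ *-monoˡ-≼ pb bound ⟩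
           b ⊗ (a ^ˢ k ⊗ ν (G S₁))       ≈⟨ mk≐ (λ i → swap (b i) ((a ^ˢ k) i) (ι (G S₁))) ⟩
           a ^ˢ k ⊗ (b ⊗ ν (G S₁))       ≲⟨ *-monoˡ-≼ (^-Pos pa k) bound₁ ⟩
           a ^ˢ k ⊗ (a ⊗ ν (G S))        ≈⟨ mk≐ (λ i → swap′ ((a ^ˢ k) i) (a i) (ι (G S))) ⟩
           a ^ˢ suc k ⊗ ν (G S)          ∎)
    where
    open ≼-Reasoning
    open +-*-Solver
    swap : ∀ p q r → p ℚ.* (q ℚ.* r) ≡ q ℚ.* (p ℚ.* r)
    swap = solve 3 (λ a b c → a :* (b :* c) := b :* (a :* c)) refl
    swap′ : ∀ p q r → p ℚ.* (q ℚ.* r) ≡ (q ℚ.* p) ℚ.* r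
    swap′ = solve 3 (λ a b c → a :* (b :* c) := (b :* a) :* c) refl

    remove-v : ∃[ S₁ ] S₁ ⊆ S × v ∉ S₁ × b ⊗ ν (G S₁) ≼ a ⊗ ν (G S)
    remove-v with v ∈? S
    ... | yes v∈S = S - v , p─q⊆p S _ , x∉p-x , step S ∣S∣≤j v v∈S
    -- Nothing is removed here, but `b ≼ a` still pays for one factor, so the exponent is `∣ R ∣`
    -- however `R` meets `S`.
    ... | no  v∉S = S , (λ x∈S → x∈S) , v∉S , *-monoʳ-≼-ν (G S) b≼a

-- Instead of subtracting the losses `X`, the term `s G₀ Φ` is added on both sides: `s (1 + Φ) G₀ ≤
-- a G₀ ≤ a G₁ + a X ≤ a G₁ + s G₀ Φ`.
removal-step : ∀ (a s Φ : Seq) G₀ G₁ X → Pos a → s ⊗ (ν 1 ⊕ Φ) ≼ a → G₀ ℕ.≤ G₁ ℕ.+ X →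
  a ⊗ ν X ≼ (s ⊗ ν G₀) ⊗ Φ → s ⊗ ν G₀ ≼ a ⊗ ν G₁
removal-step a s Φ G₀ G₁ X pa sϕ≼a G₀≤G₁+X aX≼ = +-cancelʳ-≼ {z = (s ⊗ ν G₀) ⊗ Φ} (begin
  s ⊗ ν G₀ ⊕ (s ⊗ ν G₀) ⊗ Φ       ≈⟨ mk≐ (λ i → factor (s i) (ι G₀) (Φ i)) ⟩
  (s ⊗ (ν 1 ⊕ Φ)) ⊗ ν G₀          ≲⟨ *-monoʳ-≼-ν G₀ sϕ≼a ⟩
  a ⊗ ν G₀                        ≲⟨ *-monoˡ-≼ pa (ν-mono G₀ (G₁ ℕ.+ X) G₀≤G₁+X) ⟩
  a ⊗ ν (G₁ ℕ.+ X)                ≈⟨ mk≐ (λ i → trans (cong (a i ℚ.*_) (ι-+ G₁ X)) (ℚₚ.*-distribˡ-+ (a i) (ι G₁) (ι X))) ⟩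
  a ⊗ ν G₁ ⊕ a ⊗ ν X              ≲⟨ +-mono-≼ (≼-refl {a ⊗ ν G₁}) aX≼ ⟩
  a ⊗ ν G₁ ⊕ (s ⊗ ν G₀) ⊗ Φ       ∎)
  where
  open ≼-Reasoning
  factor : ∀ s g p → s ℚ.* g ℚ.+ (s ℚ.* g) ℚ.* p ≡ (s ℚ.* (1ℚ ℚ.+ p)) ℚ.* g
  factor = solve 3 (λ s g p → s :* g :+ (s :* g) :* p := (s :* (con 1ℚ :+ p)) :* g) refl
    where open +-*-Solver

per-size-bound : ∀ (s t : Seq) r N X G → Pos t → ν (N ℕ.* X) ≼ (s ⊗ t ^ˢ r) ⊗ ν G →
  (ν N ⊗ t) ⊗ ν X ≼ (s ⊗ ν G) ⊗ t ^ˢ suc r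
per-size-bound s t r N X G pt NX≼ = begin
  (ν N ⊗ t) ⊗ ν X                   ≈⟨ mk≐ (λ i → trans (rotate (ι N) (t i) (ι X)) (cong (t i ℚ.*_) (sym (ι-* N X)))) ⟩
  t ⊗ ν (N ℕ.* X)                   ≲⟨ *-monoˡ-≼ pt NX≼ ⟩
  t ⊗ ((s ⊗ t ^ˢ r) ⊗ ν G)          ≈⟨ mk≐ (λ i → regroup′ (t i) (s i) ((t ^ˢ r) i) (ι G)) ⟩
  (s ⊗ ν G) ⊗ t ^ˢ suc r            ∎
  where
  open ≼-Reasoning
  open +-*-Solver
  rotate : ∀ p q r → (p ℚ.* q) ℚ.* r ≡ q ℚ.* (p ℚ.* r)
  rotate = solve 3 (λ p q r → (p :* q) :* r := q :* (p :* r)) refl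
  regroup′ : ∀ t s u g → t ℚ.* ((s ℚ.* u) ℚ.* g) ≡ (s ℚ.* g) ℚ.* (t ℚ.* u)
  regroup′ = solve 4 (λ t s u g → t :* ((s :* u) :* g) := (s :* g) :* (t :* u)) refl

*ϕ-≼ : ∀ (s t γ Φ : Seq) → Pos s → ν 1 ⊕ Φ ≼ t ⊗ γ → s ⊗ (ν 1 ⊕ Φ) ≼ (γ ⊗ s) ⊗ t
*ϕ-≼ s t γ Φ ps ϕ≼tγ = begin
  s ⊗ (ν 1 ⊕ Φ)   ≲⟨ *-monoˡ-≼ ps ϕ≼tγ ⟩
  s ⊗ (t ⊗ γ)     ≈⟨ mk≐ (λ j → rotate (s j) (t j) (γ j)) ⟩
  (γ ⊗ s) ⊗ t     ∎
  where
  open ≼-Reasoning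
  open +-*-Solver
  rotate : ∀ p q r → p ℚ.* (q ℚ.* r) ≡ (r ℚ.* p) ℚ.* q
  rotate = solve 3 (λ p q r → p :* (q :* r) := (r :* p) :* q) refl

≼-*1+ : ∀ (s Φ : Seq) → Pos s → ν 0 ≼ Φ → s ≼ s ⊗ (ν 1 ⊕ Φ)
≼-*1+ s Φ ps 0≼Φ = begin
  s                 ≈⟨ mk≐ (λ j → ℚₚ.*-identityʳ (s j)) ⟨
  s ⊗ ν 1           ≲⟨ *-monoˡ-≼ ps (≼-trans (≐⇒≼ (mk≐ λ _ → refl)) (+-mono-≼ (≼-refl {ν 1}) 0≼Φ)) ⟩
  s ⊗ (ν 1 ⊕ Φ)     ∎
  where open ≼-Reasoning

-- Colorings enter only through the two counting inequalities `G-≤` and `H-≤`. In `H-≤` both `R` and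
-- `m` are existential: `R` depends on `v`, and `Q` lists sets, several indices of which may carry
-- different constants.
module Induction {n : ℕ} (G : Subset n → ℕ) (H : Subset n → Subset n → ℕ)
  (E : List ℕ) (Q : ℕ → Fin n → List (Subset n)) (d : ℕ → ℕ)
  (0<E : ∀ {e} → e ∈ E → 0 ℕ.< e)
  (∣Q∣≤d : ∀ e v → length (Q e v) ℕ.≤ d e)
  (N : ℕ) (s t : Seq) (ps : Pos s) (pt : Pos t)
  (sϕ≼a : s ⊗ (ν 1 ⊕ powers E t) ≼ ν N ⊗ t)
  (G-≤ : ∀ S T v → (∀ {x} → x ∈ˢ T → x ∈ˢ S ⊎ x ≡ v) →
    G S ℕ.≤ G T ℕ.+ ∑ (λ e → ∑ (H S) (Q e v)) E)
  (H-≤ : ∀ r v Y → Y ∈ Q (suc r) v → ∃[ R ] ∃[ m ]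
    v ∈ˢ R × ∣ R ∣ ≡ suc r × ν (d (suc r) ℕ.* m) ≼ s ^ˢ suc r ×
    (∀ S S′ → S′ ⊆ S → (∀ w → w ∈ˢ S′ → w ∉ R) → N ℕ.^ suc r ℕ.* H S Y ℕ.≤ m ℕ.* G S′))
  where

  a : Seq
  a = ν N ⊗ t

  s≼a : s ≼ a
  s≼a = ≼-trans (≼-*1+ s (powers E t) ps (0≼powers E pt)) sϕ≼a

  pa : Pos a
  pa = Pos-≼ ps (*-bounded (ν-bounded N) (isBounded pt)) s≼a

  -- For `N = 0` the sequence `a` would vanish, although it dominates `s`.
  0<N : 0 ℕ.< N
  0<N = ℕₚ.n≢0⇒n>0 λ { refl → Pos⇒¬≼0 pa (≐⇒≼ (*-zeroˡ-≐ t)) }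

  step : ∀ j S → ∣ S ∣ ℕ.≤ j → Step G pa ps s≼a S
  step zero S ∣S∣≤0 v v∈S =
    contradiction (ℕₚ.<-≤-trans (x∈p⇒∣p-x∣<∣p∣ v∈S) ∣S∣≤0) λ ()
  step (suc j) S ∣S∣≤1+j v v∈S = removal-step a s (powers E t) (G S₀) (G S) (∑ hits E) pa sϕ≼a
    (G-≤ S₀ S v S⊆S₀∪v) (∑-≼-powers {s ⊗ ν (G S₀)} {t} {a} hits E (per-size _))
    where
    S₀ = S - v

    ∣S₀∣≤j : ∣ S₀ ∣ ℕ.≤ j
    ∣S₀∣≤j = ℕ.s≤s⁻¹ (ℕₚ.≤-trans (x∈p⇒∣p-x∣<∣p∣ v∈S) ∣S∣≤1+j)

    S⊆S₀∪v : ∀ {x} → x ∈ˢ S → x ∈ˢ S₀ ⊎ x ≡ v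
    S⊆S₀∪v {x} x∈S with x ≟ᶠ v
    ... | yes x≡v = inj₂ x≡v
    ... | no  x≢v = inj₁ (x∈p∧x≢y⇒x∈p-y x∈S x≢v)

    hits : ℕ → ℕ
    hits e = ∑ (H S₀) (Q e v)

    per-set : ∀ r {Y} → Y ∈ Q (suc r) v →
      ν (d (suc r) ℕ.* (N ℕ.* H S₀ Y)) ≼ (s ⊗ t ^ˢ r) ⊗ ν (G S₀)
    per-set r {Y} Y∈Q =
      let R , m , v∈R , ∣R∣≡1+r , dm≼ , bound = H-≤ r v Y Y∈Q
      in conclude R m v∈R dm≼ (bound S₀)
           (removal G pa ps s≼a j (step j) r (R - v) S₀ ∣S₀∣≤j
             (ℕₚ.suc-injective (trans (∣p-x∣+1≡∣p∣ v∈R) ∣R∣≡1+r)))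
      where
      conclude : ∀ R m → v ∈ˢ R → ν (d (suc r) ℕ.* m) ≼ s ^ˢ suc r →
        (∀ S′ → S′ ⊆ S₀ → (∀ w → w ∈ˢ S′ → w ∉ R) → N ℕ.^ suc r ℕ.* H S₀ Y ℕ.≤ m ℕ.* G S′) →
        (∃[ S′ ] S′ ⊆ S₀ × (∀ w → w ∈ˢ S′ → w ∉ R - v) × s ^ˢ r ⊗ ν (G S′) ≼ a ^ˢ r ⊗ ν (G S₀)) →
        ν (d (suc r) ℕ.* (N ℕ.* H S₀ Y)) ≼ (s ⊗ t ^ˢ r) ⊗ ν (G S₀)
      conclude R m v∈R dm≼ bound (S′ , S′⊆S₀ , disjoint , removed) =
        per-set-bound r (d (suc r)) m N (H S₀ Y) (G S₀) (G S′) ps pt 0<N dm≼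
          -- Removal cleared only `R - v`; the vertex `v` is missing from `S′` because it is missing
          -- from `S₀`.
          (bound S′ S′⊆S₀ λ w w∈S′ w∈R → disjoint w w∈S′
            (x∈p∧x≢y⇒x∈p-y w∈R λ { refl → x∉p-x (S′⊆S₀ w∈S′) }))
          removed

    per-size : ∀ e → e ∈ E → a ⊗ ν (hits e) ≼ (s ⊗ ν (G S₀)) ⊗ t ^ˢ e
    per-size zero    e∈E = contradiction (0<E e∈E) λ ()
    per-size (suc r) _   = per-size-bound s t r N (hits (suc r)) (G S₀) pt
      (subst (λ x → ν x ≼ (s ⊗ t ^ˢ r) ⊗ ν (G S₀)) (∑-*ˡ N (H S₀) (Q (suc r) v))
        (∑-≼-average {x = s ⊗ t ^ˢ r} (λ Y → N ℕ.* H S₀ Y) (d (suc r)) (G S₀)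
          (Q (suc r) v) (*-Pos ps (^-Pos pt r)) (∣Q∣≤d (suc r) v) (per-set r)))

  -- Removing all `n` vertices gives `s^n G(∅) ≤ a^n G(⊤)`, whose left side is bounded away from 0.
  -- The hypothesis speaks of any `S` without elements because `removal` describes its result only
  -- in that way.
  0<G⊤ : (∀ S → (∀ v → ¬ (v ∈ˢ S)) → 0 ℕ.< G S) → 0 ℕ.< G ⊤
  0<G⊤ 0<G∅ = ℕₚ.n≢0⇒n>0 λ G⊤≡0 →
    let S′ , _ , disjoint , bound = removal G pa ps s≼a n (step n) n ⊤ ⊤ (∣p∣≤n ⊤) (∣⊤∣≡n n)
    in Pos⇒¬≼0 (*-Pos (^-Pos ps n) (ν-Pos (G S′) (0<G∅ S′ λ v v∈S′ → disjoint v v∈S′ ∈⊤)))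
         (≼-trans bound (≼-trans (≼-reflexive (cong (λ g → a ^ˢ n ⊗ ν g) G⊤≡0))
           (≐⇒≼ (*-zeroʳ-≐ (a ^ˢ n)))))

-- The induction applied to a family of bad settings

module Core
  (em : ExcludedMiddle 0ℓ) {n : ℕ} (Bad : BadSettings n) (I : List ℕ) (Z : ℕ → Subset n)
  (family : ∀ Y → (∃[ c ] Bad Y c) ⇔ (∃[ i ] i ∈ I × Z i ≡ Y))
  (k m : ℕ → ℕ)
  (few : ∀ i → i ∈ I →
    k i ℕ.< ∣ Z i ∣ × 1 ℕ.≤ m i × FewExtensions (Z i) (Bad (Z i)) (k i) (m i))
  where

  open Family I Z k
  open Counting em Bad

  Z-nonempty : ∀ {i} → i ∈ I → ∃[ v ] v ∈ˢ Z i
  Z-nonempty {i} i∈I with nonempty? (Z i)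
  ... | yes ne = ne
  ... | no  ∄  = contradiction (proj₁ (few i i∈I))
    (subst (λ c → ¬ (k i ℕ.< c)) (sym (trans (cong ∣_∣ (Empty-unique ∄)) (∣⊥∣≡0 n))) λ ())

  0<l : ∀ {i} → i ∈ I → 0 ℕ.< l i
  0<l i∈I = ℕₚ.m<n⇒0<n∸m (proj₁ (few _ i∈I))

  ∣Q∣≤d : ∀ e v → length (Q e v) ℕ.≤ d e
  ∣Q∣≤d e v = All.lookup (xs≤max 0 (map (λ v → length (Q e v)) (allFin n)))
    (∈-map⁺ (λ v → length (Q e v)) (∈-allFin v))

  -- As `k i < ∣ Z i ∣`, the set `Z i` has a vertex `v` and is itself counted in `Q (l i) v`. This
  -- is what makes the supremum at least 1.
  1≤dm : ∀ {i} → i ∈ I → 1 ℕ.≤ d (l i) ℕ.* m i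
  1≤dm {i} i∈I =
    let v , v∈Z = Z-nonempty i∈I
        1≤∣Q∣ = ∈⇒0<length (∈-Q⁺ 0 k family i∈I v∈Z)
    in ℕₚ.*-mono-≤ (ℕₚ.≤-trans 1≤∣Q∣ (∣Q∣≤d (l i) v)) (proj₁ (proj₂ (few i i∈I)))
    where
    ∈⇒0<length : ∀ {x : A} {xs} → x ∈ xs → 0 ℕ.< length xs
    ∈⇒0<length (here _)  = s≤s z≤n
    ∈⇒0<length (there _) = s≤s z≤n

  module _ (s t : Seq) (ps : Pos s) (pt : Pos t)
    (dm≼s^l : ∀ {i} → i ∈ I → ν (d (l i) ℕ.* m i) ≼ s ^ˢ l i)
    (N : ℕ) (sϕ≼a : s ⊗ (ν 1 ⊕ powers E t) ≼ ν N ⊗ t) where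

    0<E : ∀ {e} → e ∈ E → 0 ℕ.< e
    0<E e∈E = let i , i∈I , e≡l = ∈-map⁻ l (∈-deduplicate⁻ ℕₚ._≟_ (map l I) e∈E) in
      subst (0 ℕ.<_) (sym e≡l) (0<l i∈I)

    H-≤ : ∀ r v Y → Y ∈ Q (suc r) v → ∃[ R ] ∃[ m ]
      v ∈ˢ R × ∣ R ∣ ≡ suc r × ν (d (suc r) ℕ.* m) ≼ s ^ˢ suc r ×
      (∀ S S′ → S′ ⊆ S → (∀ w → w ∈ˢ S′ → w ∉ R) →
        N ℕ.^ suc r ℕ.* #hits N S Y ℕ.≤ m ℕ.* #good N S′)
    H-≤ r v Y Y∈Q = witness (∈-Q⁻ N k family Y∈Q)
      where
      witness : ∀ {Y} → ∃[ i ] i ∈ I × Z i ≡ Y × v ∈ˢ Z i × l i ≡ suc r → ∃[ R ] ∃[ m ]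
        v ∈ˢ R × ∣ R ∣ ≡ suc r × ν (d (suc r) ℕ.* m) ≼ s ^ˢ suc r ×
        (∀ S S′ → S′ ⊆ S → (∀ w → w ∈ˢ S′ → w ∉ R) →
          N ℕ.^ suc r ℕ.* #hits N S Y ℕ.≤ m ℕ.* #good N S′)
      witness (i , i∈I , refl , v∈Z , l≡1+r) =
        let _ , _ , extend = few i i∈I
            K , K⊆Z-v , ∣K∣≡k , atMost = extend v v∈Z
            K⊆Z : K ⊆ Z i
            K⊆Z = p─q⊆p (Z i) _ ∘ K⊆Z-v
            ∣R∣≡1+r : ∣ Z i ─ K ∣ ≡ suc r
            ∣R∣≡1+r = trans (trans (sym (ℕₚ.m+n∸n≡m ∣ Z i ─ K ∣ ∣ K ∣))
              (cong₂ ℕ._∸_ (∣p─q∣+∣q∣≡∣p∣ (Z i) K K⊆Z) ∣K∣≡k)) l≡1+r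
        in Z i ─ K , m i , x∈p∧x∉q⇒x∈p─q v∈Z (x∉p-x ∘ K⊆Z-v) , ∣R∣≡1+r ,
           subst (λ e → ν (d e ℕ.* m i) ≼ s ^ˢ e) l≡1+r (dm≼s^l i∈I) ,
           λ S S′ S′⊆S disjoint → subst (λ e → N ℕ.^ e ℕ.* #hits N S (Z i) ℕ.≤ m i ℕ.* #good N S′)
             ∣R∣≡1+r (#hits-≤ N K⊆Z atMost S′⊆S disjoint)

    open Induction (#good N) (#hits N) E Q d 0<E ∣Q∣≤d N s t ps pt sϕ≼a
      (λ S T v → #good-≤ N k family {S} {T} {v}) H-≤

    exists-coloring : ∃[ f ] (∀ (v : Fin n) → f v ℕ.< N) × Avoids Bad f
    exists-coloring =
      -- Every coloring is good for a set without elements, since bad settings live on the nonempty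
      -- sets `Z i`.
      let g , g<N , good = 0<#good⇒∃ N ⊤ (0<G⊤ λ S ∅ → 0<#good N 0<N S λ g Y Y⊆S c bad _ →
            let i , i∈I , Zi≡Y = Equivalence.to (family Y) (c , bad)
                v , v∈Zi = Z-nonempty i∈I
            in ∅ v (Y⊆S (subst (v ∈ˢ_) Zi≡Y v∈Zi)))
      in lookup g , g<N , λ Y c bad → good Y (λ _ → ∈⊤) c bad

-- From real numbers to sequences, and the conclusion

root-≥1 : ∀ l {a} → 0 ℕ.< l → 1 ℕ.≤ a → ν 1 ≼ seq (root l a)
root-≥1 (suc l) _ = 1≼root l

root-^ : ∀ l {a} → 0 ℕ.< l → 1 ℕ.≤ a → ν a ≼ seq (root l a) ^ˢ l
root-^ (suc l) _ = ν≼root^ l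

≤ℝ⇒≼ : ∀ x y → x ≤ℝ y → seq x ≼ seq y
≤ℝ⇒≼ x y x≤y = mk≼ x≤y

≈0⇒≼ : ∀ x y → x -ℝ y ≈ℝ 0ℝ → seq x ≼ seq y
≈0⇒≼ x y x-y≈0 = mk≼ λ ε 0<ε →
  let M , h = x-y≈0 ε 0<ε in M , λ j M≤j →
  ℚₚ.<⇒≤ (<+ (subst (λ p → ℚ.∣ p ∣ ℚ.< ε) (ℚₚ.+-identityʳ (seq x j ℚ.- seq y j)) (h j M≤j)))

theorem1 :
  ExcludedMiddle 0ℓ →
  (n : ℕ) (Bad : BadSettings n)
  (I : List ℕ) (Z : ℕ → Subset n) →
  (∀ Y → (∃[ c ] Bad Y c) ⇔ (∃[ i ] i ∈ I × Z i ≡ Y)) →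
  (k m : ℕ → ℕ) →
  (∀ i → i ∈ I → k i < ∣ Z i ∣ × 1 ≤ m i × FewExtensions (Z i) (Bad (Z i)) (k i) (m i)) →
  let open Family I Z k in
  (τ : ℝ) → 0ℝ <ℝ τ →
  eval (ϕ E) τ -ℝ τ *ℝ eval (derivative (ϕ E)) τ ≈ℝ 0ℝ →
  let γ = eval (derivative (ϕ E)) τ in
  ∃[ N ] IsCeiling (γ *ℝ sup I (λ i → root (l i) (d (l i) * m i))) N ×
    (∃[ f ] (∀ (v : Fin n) → f v < N) × Avoids Bad f)
theorem1 em n Bad I Z family k m few τ (ε , 0<ε , M , ε≤τ) stationary =
  color (ceiling em (γℝ *ℝ sℝ) γs≰0)
  where
  open Family I Z k
  open Core em Bad I Z family k m few

  γℝ sℝ : ℝ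
  γℝ = eval (derivative (ϕ E)) τ
  sℝ = sup I (λ i → root (l i) (d (l i) ℕ.* m i))

  t γ s : Seq
  t = seq τ
  γ = seq γℝ
  s = seq sℝ

  pt : Pos t
  pt = mkPos (ε , 0<ε , M , λ j M≤j → subst (ℚ._≤ t j) (ℚₚ.+-identityˡ ε) (ε≤τ j M≤j)) (seq-bounded τ)

  ϕ≼tγ : ν 1 ⊕ powers E t ≼ t ⊗ γ
  ϕ≼tγ = ≼-trans (≐⇒≼ (≐-sym (eval-ϕ E τ))) (≈0⇒≼ (eval (ϕ E) τ) (τ *ℝ γℝ) stationary)

  root≼s : ∀ {i} → i ∈ I → seq (root (l i) (d (l i) ℕ.* m i)) ≼ s
  root≼s = sup-upper (λ i → root (l i) (d (l i) ℕ.* m i))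

  root-Pos : ∀ {i} → i ∈ I → Pos (seq (root (l i) (d (l i) ℕ.* m i)))
  root-Pos {i} i∈I = Pos-≼ (ν-Pos 1 (s≤s z≤n)) (seq-bounded (root (l i) (d (l i) ℕ.* m i)))
    (root-≥1 (l i) (0<l i∈I) (1≤dm i∈I))

  dm≼s^l : ∀ {i} → i ∈ I → ν (d (l i) ℕ.* m i) ≼ s ^ˢ l i
  dm≼s^l {i} i∈I = ≼-trans (root-^ (l i) (0<l i∈I) (1≤dm i∈I))
    (^-mono-≼ (root-Pos i∈I) (seq-bounded sℝ) (root≼s i∈I) (l i))

  s-Pos : ∀ {i} → i ∈ I → Pos s
  s-Pos i∈I = Pos-≼ (root-Pos i∈I) (seq-bounded sℝ) (root≼s i∈I)

  -- For empty `I` the polynomial is the constant 1 with derivative 0, and stationarity would read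
  -- `1 = 0`.
  I-nonempty : ∃[ i ] i ∈ I
  I-nonempty = nonempty I ϕ≼tγ′
    where
    ϕ≼tγ′ : ν 1 ⊕ powers (Family.E I Z k) t ≼ t ⊗ seq (eval (derivative (ϕ (Family.E I Z k))) τ)
    ϕ≼tγ′ = ϕ≼tγ
    nonempty : ∀ J → ν 1 ⊕ powers (Family.E J Z k) t ≼
      t ⊗ seq (eval (derivative (ϕ (Family.E J Z k))) τ) → ∃[ i ] i ∈ J
    nonempty []      1≼0 = contradiction
      (≼-trans (≐⇒≼ (mk≐ λ _ → refl)) (≼-trans 1≼0 (≐⇒≼ (*-zeroʳ-≐ t))))
      (Pos⇒¬≼0 (ν-Pos 1 (s≤s z≤n)))
    nonempty (i ∷ _) _   = i , here refl

  ps : Pos s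
  ps = s-Pos (proj₂ I-nonempty)

  sϕ≼γst : s ⊗ (ν 1 ⊕ powers E t) ≼ (γ ⊗ s) ⊗ t
  sϕ≼γst = *ϕ-≼ s t γ (powers E t) ps ϕ≼tγ

  -- From `0 < s ≤ s ϕ_E(τ) ≤ γ s τ` the product `γ s` cannot be at most 0.
  γs≰0 : ¬ (γ ⊗ s ≼ ν 0)
  γs≰0 γs≼0 = Pos⇒¬≼0 ps (≼-trans (≼-*1+ s (powers E t) ps (0≼powers E pt))
    (≼-trans sϕ≼γst (≼-trans (*-monoʳ-≼ pt γs≼0) (≐⇒≼ (*-zeroˡ-≐ t)))))

  color : ∃[ N ] IsCeiling (γℝ *ℝ sℝ) N →
    ∃[ N ] IsCeiling (γℝ *ℝ sℝ) N × (∃[ f ] (∀ (v : Fin n) → f v ℕ.< N) × Avoids Bad f)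
  color (N , γs≤N , N<γs+1) = N , (γs≤N , N<γs+1) ,
    exists-coloring s t ps pt dm≼s^l N
      (≼-trans sϕ≼γst (*-monoʳ-≼ pt (≤ℝ⇒≼ (γℝ *ℝ sℝ) (fromℕ N) γs≤N)))
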